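{- Suppose a graph $G$ has a convex compact visibility representation in which two sightlines $\overline{ab}$ and $\overline{vw}$ intersect, where $a,b,v,w$ lie in four distinct regions $A,B,V,W$ respectively. Then the vertices $A$ and $B$ lie in a common subgraph of $G$ isomorphic to $K_4$.
   Context: All graphs are finite and simple. Given a family of pairwise disjoint nonempty connected subsets ("regions") of $\mathbb{R}^2$, a sightline is a closed line segment $\overline{ab}$ with $a\in A$, $b\in B$ for two different regions $A\neq B$ of the family, such that the segment intersects no region of the family other than $A$ and $B$. A visibility representation of $G$ is such a family with one region per vertex, such that two distinct vertices are adjacent in $G$ if and only if there is a sightline between their regions; it is convex compact if every region is compact and convex. Vertices are identified with their regions. -}

module Defs where

open import Data.Fin.Base using (Fin)
open import Data.List.Base using (List)
open import Data.List.Relation.Unary.Any using (Any)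
open import Data.Nat.Base as ℕ using (ℕ)
import Data.Nat.Properties as ℕ
open import Data.Product.Base using (_×_; _,_; ∃-syntax)
open import Data.Rational.Base as ℚ using (ℚ; 0ℚ; 1ℚ; ½; ∣_∣)
import Data.Rational.Properties as ℚ
open import Data.Rational.Solver using (module +-*-Solver)
open import Function.Bundles using (_⇔_)
open import Function.Definitions using (Injective)
open import Level using (0ℓ)
open import Relation.Binary.Core using (Rel)
open import Relation.Binary.Definitions using (Symmetric; Irreflexive)
open import Relation.Binary.PropositionalEquality
  using (_≡_; _≢_; refl; sym; trans; cong; cong₂; subst; ≢-sym)
open import Relation.Nullary.Negation using (¬_)
open import Relation.Unary using (Pred; _∈_; _⊆_; _∪_; _∩_; Empty; Satisfiable)

-- ℝ, as Cauchy sequences of rationals modulo null sequences. It is a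
-- setoid: `_≈_` is equality of real numbers.

IsCauchy : (ℕ → ℚ) → Set
IsCauchy x = ∀ ε → 0ℚ ℚ.< ε → ∃[ N ] ∀ m n → N ℕ.≤ m → N ℕ.≤ n →
             ∣ x m ℚ.- x n ∣ ℚ.< ε

record ℝ : Set where
  constructor mkℝ
  field
    seq    : ℕ → ℚ
    cauchy : IsCauchy seq

open ℝ public

private
  half-pos : ∀ {ε} → 0ℚ ℚ.< ε → 0ℚ ℚ.< ½ ℚ.* ε
  half-pos {ε} 0<ε = subst (ℚ._< ½ ℚ.* ε) (ℚ.*-zeroʳ ½) (ℚ.*-monoʳ-<-pos ½ 0<ε)

  half+half : ∀ ε → ½ ℚ.* ε ℚ.+ ½ ℚ.* ε ≡ ε
  half+half ε = trans (sym (ℚ.*-distribʳ-+ ε ½ ½)) (ℚ.*-identityˡ ε)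

  +-diff : ∀ a b c d → (a ℚ.+ b) ℚ.- (c ℚ.+ d) ≡ (a ℚ.- c) ℚ.+ (b ℚ.- d)
  +-diff = solve 4 (λ a b c d → (a :+ b) :- (c :+ d) := (a :- c) :+ (b :- d)) refl
    where open +-*-Solver

  *-diff : ∀ a b c d →
           a ℚ.* b ℚ.- c ℚ.* d ≡ a ℚ.* (b ℚ.- d) ℚ.+ (a ℚ.- c) ℚ.* d
  *-diff = solve 4 (λ a b c d → a :* b :- c :* d := a :* (b :- d) :+ (a :- c) :* d) refl
    where open +-*-Solver

  neg-diff : ∀ a b → ℚ.- a ℚ.- ℚ.- b ≡ ℚ.- (a ℚ.- b)
  neg-diff = solve 2 (λ a b → :- a :- :- b := :- (a :- b)) refl
    where open +-*-Solver

  split-diff : ∀ a b → a ≡ (a ℚ.- b) ℚ.+ b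
  split-diff = solve 2 (λ a b → a := (a :- b) :+ b) refl
    where open +-*-Solver

abstract
  const-cauchy : ∀ q → IsCauchy (λ _ → q)
  const-cauchy q ε 0<ε = 0 , λ _ _ _ _ →
    subst (ℚ._< ε) (sym (cong ∣_∣ (ℚ.+-inverseʳ q))) 0<ε

  +-cauchy : ∀ x y → IsCauchy x → IsCauchy y → IsCauchy (λ n → x n ℚ.+ y n)
  +-cauchy x y cx cy ε 0<ε
    with M , hx ← cx (½ ℚ.* ε) (half-pos 0<ε)
       | N , hy ← cy (½ ℚ.* ε) (half-pos 0<ε)
    = M ℕ.⊔ N , λ m n m≥ n≥ → begin-strict
      ∣ (x m ℚ.+ y m) ℚ.- (x n ℚ.+ y n) ∣
        ≡⟨ cong ∣_∣ (+-diff (x m) (y m) (x n) (y n)) ⟩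
      ∣ (x m ℚ.- x n) ℚ.+ (y m ℚ.- y n) ∣
        ≤⟨ ℚ.∣p+q∣≤∣p∣+∣q∣ (x m ℚ.- x n) (y m ℚ.- y n) ⟩
      ∣ x m ℚ.- x n ∣ ℚ.+ ∣ y m ℚ.- y n ∣
        <⟨ ℚ.+-mono-< (hx m n (ℕ.m⊔n≤o⇒m≤o M N m≥) (ℕ.m⊔n≤o⇒m≤o M N n≥))
                      (hy m n (ℕ.m⊔n≤o⇒n≤o M N m≥) (ℕ.m⊔n≤o⇒n≤o M N n≥)) ⟩
      ½ ℚ.* ε ℚ.+ ½ ℚ.* ε
        ≡⟨ half+half ε ⟩
      ε ∎
    where open ℚ.≤-Reasoning

  neg-cauchy : ∀ x → IsCauchy x → IsCauchy (λ n → ℚ.- x n)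
  neg-cauchy x cx ε 0<ε with N , hx ← cx ε 0<ε = N , λ m n m≥ n≥ →
    subst (ℚ._< ε)
          (sym (trans (cong ∣_∣ (neg-diff (x m) (x n))) (ℚ.∣-p∣≡∣p∣ (x m ℚ.- x n))))
          (hx m n m≥ n≥)

  eventually-bounded : ∀ x → IsCauchy x →
    ∃[ B ] ℚ.Positive B × (∃[ N ] ∀ n → N ℕ.≤ n → ∣ x n ∣ ℚ.≤ B)
  eventually-bounded x cx with N , hx ← cx 1ℚ (ℚ.positive⁻¹ 1ℚ)
    = 1ℚ ℚ.+ ∣ x N ∣
    , ℚ.positive (ℚ.+-mono-<-≤ (ℚ.positive⁻¹ 1ℚ) (ℚ.0≤∣p∣ (x N)))
    , N , λ n n≥ → begin
      ∣ x n ∣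
        ≡⟨ cong ∣_∣ (split-diff (x n) (x N)) ⟩
      ∣ (x n ℚ.- x N) ℚ.+ x N ∣
        ≤⟨ ℚ.∣p+q∣≤∣p∣+∣q∣ (x n ℚ.- x N) (x N) ⟩
      ∣ x n ℚ.- x N ∣ ℚ.+ ∣ x N ∣
        ≤⟨ ℚ.+-monoˡ-≤ ∣ x N ∣ (ℚ.<⇒≤ (hx n N n≥ ℕ.≤-refl)) ⟩
      1ℚ ℚ.+ ∣ x N ∣ ∎
    where open ℚ.≤-Reasoning

  shrink : ∀ D ε → .{{ℚ.Positive D}} → 0ℚ ℚ.< ε → ∃[ δ ] 0ℚ ℚ.< δ × D ℚ.* δ ≡ ε
  shrink D ε 0<ε = D⁻¹ ℚ.* ε
    , subst (ℚ._< D⁻¹ ℚ.* ε) (ℚ.*-zeroʳ D⁻¹)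
            (ℚ.*-monoʳ-<-pos D⁻¹ {{ℚ.1/pos⇒pos D}} 0<ε)
    , trans (sym (ℚ.*-assoc D D⁻¹ ε))
            (trans (cong (ℚ._* ε) (ℚ.*-inverseʳ D {{ℚ.pos⇒nonZero D}})) (ℚ.*-identityˡ ε))
    where
    D⁻¹ : ℚ
    D⁻¹ = ℚ.1/_ D {{ℚ.pos⇒nonZero D}}

  *-estimate : ∀ B C δ → .{{ℚ.Positive B}} → .{{ℚ.Positive C}} → ∀ a b c d →
    ∣ a ∣ ℚ.≤ B → ∣ d ∣ ℚ.≤ C → ∣ a ℚ.- c ∣ ℚ.< δ → ∣ b ℚ.- d ∣ ℚ.< δ →
    ∣ a ℚ.* b ℚ.- c ℚ.* d ∣ ℚ.< (B ℚ.+ C) ℚ.* δ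
  *-estimate B C δ a b c d a≤B d≤C a-c<δ b-d<δ = begin-strict
    ∣ a ℚ.* b ℚ.- c ℚ.* d ∣
      ≡⟨ cong ∣_∣ (*-diff a b c d) ⟩
    ∣ a ℚ.* (b ℚ.- d) ℚ.+ (a ℚ.- c) ℚ.* d ∣
      ≤⟨ ℚ.∣p+q∣≤∣p∣+∣q∣ (a ℚ.* (b ℚ.- d)) ((a ℚ.- c) ℚ.* d) ⟩
    ∣ a ℚ.* (b ℚ.- d) ∣ ℚ.+ ∣ (a ℚ.- c) ℚ.* d ∣
      ≡⟨ cong₂ ℚ._+_ (ℚ.∣p*q∣≡∣p∣*∣q∣ a (b ℚ.- d)) (ℚ.∣p*q∣≡∣p∣*∣q∣ (a ℚ.- c) d) ⟩
    ∣ a ∣ ℚ.* ∣ b ℚ.- d ∣ ℚ.+ ∣ a ℚ.- c ∣ ℚ.* ∣ d ∣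
      ≤⟨ ℚ.+-mono-≤
           (ℚ.*-monoʳ-≤-nonNeg ∣ b ℚ.- d ∣ {{ℚ.nonNegative (ℚ.0≤∣p∣ (b ℚ.- d))}} a≤B)
           (ℚ.*-monoˡ-≤-nonNeg ∣ a ℚ.- c ∣ {{ℚ.nonNegative (ℚ.0≤∣p∣ (a ℚ.- c))}} d≤C) ⟩
    B ℚ.* ∣ b ℚ.- d ∣ ℚ.+ ∣ a ℚ.- c ∣ ℚ.* C
      <⟨ ℚ.+-mono-< (ℚ.*-monoʳ-<-pos B b-d<δ) (ℚ.*-monoˡ-<-pos C a-c<δ) ⟩
    B ℚ.* δ ℚ.+ δ ℚ.* C
      ≡⟨ cong (B ℚ.* δ ℚ.+_) (ℚ.*-comm δ C) ⟩
    B ℚ.* δ ℚ.+ C ℚ.* δ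
      ≡⟨ ℚ.*-distribʳ-+ δ B C ⟨
    (B ℚ.+ C) ℚ.* δ ∎
    where open ℚ.≤-Reasoning

  *-cauchy : ∀ x y → IsCauchy x → IsCauchy y → IsCauchy (λ n → x n ℚ.* y n)
  *-cauchy x y cx cy ε 0<ε =
    let B , B>0 , K , x≤B = eventually-bounded x cx
        C , C>0 , L , y≤C = eventually-bounded y cy
        δ , 0<δ , [B+C]δ≡ε =
          shrink (B ℚ.+ C) ε {{ℚ.pos+pos⇒pos B {{B>0}} C {{C>0}}}} 0<ε
        M , hx = cx δ 0<δ
        N , hy = cy δ 0<δ
    in (M ℕ.⊔ N) ℕ.⊔ (K ℕ.⊔ L) , λ m n m≥ n≥ →
       let m≥MN = ℕ.m⊔n≤o⇒m≤o (M ℕ.⊔ N) (K ℕ.⊔ L) m≥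
           n≥MN = ℕ.m⊔n≤o⇒m≤o (M ℕ.⊔ N) (K ℕ.⊔ L) n≥
           m≥KL = ℕ.m⊔n≤o⇒n≤o (M ℕ.⊔ N) (K ℕ.⊔ L) m≥
           n≥KL = ℕ.m⊔n≤o⇒n≤o (M ℕ.⊔ N) (K ℕ.⊔ L) n≥
       in subst (∣ x m ℚ.* y m ℚ.- x n ℚ.* y n ∣ ℚ.<_) [B+C]δ≡ε
            (*-estimate B C δ {{B>0}} {{C>0}} (x m) (y m) (x n) (y n)
              (x≤B m (ℕ.m⊔n≤o⇒m≤o K L m≥KL)) (y≤C n (ℕ.m⊔n≤o⇒n≤o K L n≥KL))
              (hx m n (ℕ.m⊔n≤o⇒m≤o M N m≥MN) (ℕ.m⊔n≤o⇒m≤o M N n≥MN))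
              (hy m n (ℕ.m⊔n≤o⇒n≤o M N m≥MN) (ℕ.m⊔n≤o⇒n≤o M N n≥MN)))

infix  4 _≈_ _<_ _≤_
infixl 6 _+_ _-_
infixl 7 _*_
infix  8 -_

fromℚ : ℚ → ℝ
fromℚ q = mkℝ (λ _ → q) (const-cauchy q)

0ℝ 1ℝ : ℝ
0ℝ = fromℚ 0ℚ
1ℝ = fromℚ 1ℚ

_+_ _*_ : ℝ → ℝ → ℝ
x + y = mkℝ (λ n → seq x n ℚ.+ seq y n) (+-cauchy (seq x) (seq y) (cauchy x) (cauchy y))
x * y = mkℝ (λ n → seq x n ℚ.* seq y n) (*-cauchy (seq x) (seq y) (cauchy x) (cauchy y))

-_ : ℝ → ℝ
-_ x = mkℝ (λ n → ℚ.- seq x n) (neg-cauchy (seq x) (cauchy x))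

_-_ : ℝ → ℝ → ℝ
x - y = x + (- y)

_≈_ _<_ _≤_ : Rel ℝ 0ℓ
x ≈ y = ∀ ε → 0ℚ ℚ.< ε → ∃[ N ] ∀ n → N ℕ.≤ n → ∣ seq x n ℚ.- seq y n ∣ ℚ.< ε
x < y = ∃[ ε ] 0ℚ ℚ.< ε × (∃[ N ] ∀ n → N ℕ.≤ n → seq x n ℚ.+ ε ℚ.< seq y n)
x ≤ y = ¬ (y < x)

Point : Set
Point = ℝ × ℝ

infix 4 _≋_

_≋_ : Rel Point 0ℓ
(x₁ , y₁) ≋ (x₂ , y₂) = x₁ ≈ x₂ × y₁ ≈ y₂

dist² : Point → Point → ℝ
dist² (x₁ , y₁) (x₂ , y₂) = (x₁ - x₂) * (x₁ - x₂) + (y₁ - y₂) * (y₁ - y₂)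

PointSet : Set₁
PointSet = Pred Point 0ℓ

-- A predicate describes a subset of ℝ² only if it does not distinguish
-- representatives of the same point.
Extensional : PointSet → Set
Extensional S = ∀ {p q} → p ≋ q → p ∈ S → q ∈ S

segment : Point → Point → PointSet
segment (x₁ , y₁) (x₂ , y₂) p =
  ∃[ t ] 0ℝ ≤ t × t ≤ 1ℝ ×
         p ≋ ((1ℝ - t) * x₁ + t * x₂ , (1ℝ - t) * y₁ + t * y₂)

Convex : PointSet → Set
Convex S = ∀ {p q} → p ∈ S → q ∈ S → segment p q ⊆ S

Open : PointSet → Set
Open U = ∀ {p} → p ∈ U → ∃[ r ] 0ℝ < r × (∀ q → dist² p q < r * r → q ∈ U)

Compact : PointSet → Set₁
Compact S = ∀ {I : Set} (U : I → PointSet) → (∀ i → Open (U i)) →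
  (∀ {p} → p ∈ S → ∃[ i ] p ∈ U i) →
  ∃[ is ] (∀ {p} → p ∈ S → Any (λ i → p ∈ U i) is)

-- Connected in the subspace topology, whose open sets are the S ∩ U with
-- U open in ℝ².
Connected : PointSet → Set₁
Connected S = ∀ U V → Open U → Open V → S ⊆ U ∪ V →
  Satisfiable (S ∩ U) → Satisfiable (S ∩ V) → ¬ Empty (S ∩ (U ∩ V))

record Graph (n : ℕ) : Set₁ where
  field
    Adjacent  : Rel (Fin n) 0ℓ
    symmetric : Symmetric Adjacent
    loopless  : Irreflexive _≡_ Adjacent

open Graph public

K : ∀ n → Graph n
K n = record
  { Adjacent  = _≢_
  ; symmetric = ≢-sym
  ; loopless  = λ i≡j i≢j → i≢j i≡j
  }

record Subgraph {n} (G : Graph n) : Set₁ where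
  field
    vertices       : Pred (Fin n) 0ℓ
    edges          : Rel (Fin n) 0ℓ
    edges-sym      : Symmetric edges
    edges⇒adjacent : ∀ {i j} → edges i j → Adjacent G i j
    edges⇒vertices : ∀ {i j} → edges i j → i ∈ vertices × j ∈ vertices

open Subgraph public

record _≅_ {m n} {G : Graph n} (S : Subgraph G) (H : Graph m) : Set where
  field
    to         : Fin m → Fin n
    injective  : Injective _≡_ _≡_ to
    image      : ∀ i → i ∈ vertices S ⇔ (∃[ k ] to k ≡ i)
    edges⇔     : ∀ k l → edges S (to k) (to l) ⇔ Adjacent H k l

record IsSightline {n} (region : Fin n → PointSet)
                   (A B : Fin n) (a b : Point) : Set where
  field
    distinct : A ≢ B
    start    : a ∈ region A
    end      : b ∈ region B
    clear    : ∀ C → C ≢ A → C ≢ B → Empty (segment a b ∩ region C)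

record VisibilityRepresentation {n} (G : Graph n) : Set₁ where
  field
    region      : Fin n → PointSet
    extensional : ∀ A → Extensional (region A)
    nonempty    : ∀ A → Satisfiable (region A)
    connected   : ∀ A → Connected (region A)
    disjoint    : ∀ {A B} → A ≢ B → Empty (region A ∩ region B)
    visibility  : ∀ {A B} → A ≢ B →
      Adjacent G A B ⇔ (∃[ a ] ∃[ b ] IsSightline region A B a b)

open VisibilityRepresentation public

ConvexCompact : ∀ {n} {G : Graph n} → VisibilityRepresentation G → Set₁
ConvexCompact R = ∀ A → Convex (region R A) × Compact (region R A)

{-# OPTIONS --safe #-}
module Submission where

-- Let h be an affine functional vanishing on the line ab, with h(v) > 0 > h(w), and let Q be the
-- strip between the parallels to vw through a and b, so that Q meets the line h = 0 in the segment
-- ab only. Consider pairs (e, f) of points of Q in regions other than A and B with h(e) > 0 > h(f)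
-- whose segment misses A and B; (v, w) is one. By compactness distinct regions have a positive
-- distance, and the points of the other regions in Q have height bounded away from 0. So, for a
-- small δ > 0, replacing one point of a pair by a point o of the triangle e a f, or of ef, lowers
-- h(e) - h(f) by δ unless o is too close to the replaced point to lie in another region. After
-- finitely many improvements by δ none is left; then A, B and the regions E, F of e, f form a K₄.
--
-- E sees F: a point o of another region on ef yields the pair (o, f) or (e, o), hence lies too
-- close to e or to f. E sees A: let l be the point of A in the triangle e a f nearest to the line
-- ef, and o a point of another region on el. If h(o) > 0, then of misses A by the choice of l, so
-- (o, f) is a pair and o is too close to e. If h(o) < 0, then (e, o) is a pair, so o is close to f
-- relative to the triangle, which on el means that it is too close to l. The remaining sightlines
-- follow by exchanging A with B and h with -h.

open import Algebra.Bundles using (CommutativeRing)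
import Algebra.Definitions.RawMonoid as RawMonoid
import Algebra.Solver.Ring as RingSolver
open import Algebra.Solver.Ring.AlmostCommutativeRing
  using (Induced-equivalence; fromCommutativeRing; _-Raw-AlmostCommutative⟶_)
open import Axiom.ExcludedMiddle using (ExcludedMiddle)
open import Data.Empty using (⊥; ⊥-elim)
open import Data.Fin.Base using (Fin; zero; suc)
import Data.Fin.Properties as Fin
open import Data.Integer.Base as ℤ using (ℤ)
import Data.Integer.Properties as ℤ
open import Data.List.Base using (List; []; _∷_; lookup)
open import Data.List.Membership.Propositional using (find)
open import Data.List.Membership.Propositional.Properties using (∈-lookup)
open import Data.List.Relation.Unary.All as All using (All; []; _∷_)
open import Data.List.Relation.Unary.All.Properties using (¬All⇒Any¬)
open import Data.List.Relation.Unary.AllPairs using (AllPairs; []; _∷_)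
open import Data.List.Relation.Unary.Any as Any using (Any; here; there)
open import Data.List.Relation.Unary.Unique.Propositional using (Unique)
open import Data.Maybe.Base using (just; nothing)
open import Data.Nat.Base as ℕ using (ℕ; zero; suc)
import Data.Nat.Properties as ℕ
open import Data.Product.Base using (_×_; _,_; ∃-syntax; proj₁; proj₂)
open import Data.Rational.Base as ℚ using (ℚ; 0ℚ; 1ℚ; ½; ∣_∣)
import Data.Rational.Properties as ℚ
open import Data.Rational.Unnormalised.Base as ℚᵘ using (mkℚᵘ)
import Data.Rational.Unnormalised.Properties as ℚᵘ
import Data.Sign.Base as Sign
open import Data.Sum.Base using (_⊎_; inj₁; inj₂)
open import Function.Base using (id)
open import Function.Bundles using (Equivalence; mk⇔)
open import Level using (0ℓ)
open import Relation.Binary.Core using (Rel)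
open import Relation.Binary.Definitions using (Symmetric; WeaklyDecidable; tri<; tri≈; tri>)
open import Relation.Binary.PropositionalEquality as ≡ using (_≡_; _≢_; ≢-sym)
import Relation.Binary.Reasoning.Setoid as SetoidReasoning
open import Relation.Nullary.Decidable using (yes; no; decidable-stable)
open import Relation.Nullary.Negation using (¬_)
open import Relation.Unary using (Pred; Satisfiable; _∈_; _∩_)

-- Segments that miss A and B can converge to one that touches A. So the pairs do not form a compact
-- set, and a pair with least h(e) - h(f) need not exist. This is why the descent goes in steps of a
-- fixed size, and why a blocking point is shown to be too close to another region instead of
-- violating minimality outright. A single number s controls all estimates: distinct regions are at
-- least s apart in the maximum norm, the other regions have height at least s in absolute value
-- inside Q, and coordinate differences between points of regions are below 1/s. The step is δ = s³.
-- A change of height below s³, against heights of at least s, corresponds to a fraction below s² of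
-- vectors whose coordinates are below 1/s, hence to a displacement below s, which cannot lead into
-- another region.

-- The canonical morphism ℤ → R supplies the coefficients of the ring solver.
module IntegerEmbedding (R : CommutativeRing 0ℓ 0ℓ) where
  open CommutativeRing R
  open import Algebra.Properties.Ring ring
    using (-‿involutive; -‿distribˡ-*; -‿distribʳ-*; -0#≈0#)
  open import Algebra.Properties.AbelianGroup +-abelianGroup using (⁻¹-∙-comm)
  open import Algebra.Properties.Semiring.Mult.TCOptimised semiring
    renaming (_×_ to _·_)
  open SetoidReasoning setoid

  ⟦_⟧ : ℤ → Carrier
  ⟦ ℤ.+ k ⟧      = k · 1#
  ⟦ ℤ.-[1+ k ] ⟧ = - (suc k · 1#)

  ⟦-⟧ : ∀ i → ⟦ ℤ.- i ⟧ ≈ - ⟦ i ⟧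
  ⟦-⟧ (ℤ.+ zero)    = sym -0#≈0#
  ⟦-⟧ (ℤ.+ (suc k)) = refl
  ⟦-⟧ ℤ.-[1+ k ]    = sym (-‿involutive _)

  ⟦⊖⟧ : ∀ j k → ⟦ j ℤ.⊖ k ⟧ ≈ j · 1# - k · 1#
  ⟦⊖⟧ zero    zero    = sym (-‿inverseʳ 0#)
  ⟦⊖⟧ zero    (suc k) = sym (+-identityˡ _)
  ⟦⊖⟧ (suc j) zero    = begin
    suc j · 1#       ≈⟨ +-identityʳ _ ⟨
    suc j · 1# + 0#  ≈⟨ +-congˡ -0#≈0# ⟨
    suc j · 1# - 0#  ∎
  ⟦⊖⟧ (suc j) (suc k) = begin
    ⟦ suc j ℤ.⊖ suc k ⟧                   ≡⟨ ≡.cong ⟦_⟧ (ℤ.[1+m]⊖[1+n]≡m⊖n j k) ⟩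
    ⟦ j ℤ.⊖ k ⟧                           ≈⟨ ⟦⊖⟧ j k ⟩
    j · 1# - k · 1#                       ≈⟨ +-congʳ (+-identityˡ _) ⟨
    0# + j · 1# - k · 1#                  ≈⟨ +-congʳ (+-congʳ (-‿inverseʳ 1#)) ⟨
    1# - 1# + j · 1# - k · 1#             ≈⟨ +-congʳ (+-assoc _ _ _) ⟩
    1# + (- 1# + j · 1#) - k · 1#         ≈⟨ +-congʳ (+-congˡ (+-comm _ _)) ⟩
    1# + (j · 1# - 1#) - k · 1#           ≈⟨ +-congʳ (+-assoc _ _ _) ⟨
    1# + j · 1# - 1# - k · 1#             ≈⟨ +-assoc _ _ _ ⟩
    1# + j · 1# + (- 1# - k · 1#)         ≈⟨ +-congˡ (⁻¹-∙-comm 1# _) ⟩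
    1# + j · 1# - (1# + k · 1#)           ≈⟨ +-cong (1+× j 1#) (-‿cong (1+× k 1#)) ⟨
    suc j · 1# - suc k · 1#               ∎

  ⟦+⟧ : ∀ i j → ⟦ i ℤ.+ j ⟧ ≈ ⟦ i ⟧ + ⟦ j ⟧
  ⟦+⟧ (ℤ.+ j)    (ℤ.+ k)    = ×-homo-+ 1# j k
  ⟦+⟧ (ℤ.+ j)    ℤ.-[1+ k ] = ⟦⊖⟧ j (suc k)
  ⟦+⟧ ℤ.-[1+ j ] (ℤ.+ k)    = trans (⟦⊖⟧ k (suc j)) (+-comm _ _)
  ⟦+⟧ ℤ.-[1+ j ] ℤ.-[1+ k ] = begin
    - (suc (suc (j ℕ.+ k)) · 1#)      ≈⟨ -‿cong (1+× (suc (j ℕ.+ k)) 1#) ⟩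
    - (1# + suc (j ℕ.+ k) · 1#)       ≈⟨ -‿cong (+-congˡ (×-homo-+ 1# (suc j) k)) ⟩
    - (1# + (suc j · 1# + k · 1#))    ≈⟨ -‿cong (+-congˡ (+-comm _ _)) ⟩
    - (1# + (k · 1# + suc j · 1#))    ≈⟨ -‿cong (+-assoc _ _ _) ⟨
    - (1# + k · 1# + suc j · 1#)      ≈⟨ -‿cong (+-congʳ (1+× k 1#)) ⟨
    - (suc k · 1# + suc j · 1#)       ≈⟨ -‿cong (+-comm _ _) ⟩
    - (suc j · 1# + suc k · 1#)       ≈⟨ ⁻¹-∙-comm _ _ ⟨
    - (suc j · 1#) - suc k · 1#       ∎

  ⟦*⟧ : ∀ i j → ⟦ i ℤ.* j ⟧ ≈ ⟦ i ⟧ * ⟦ j ⟧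
  ⟦*⟧ (ℤ.+ j) (ℤ.+ k) = begin
    ⟦ Sign.+ ℤ.◃ j ℕ.* k ⟧  ≡⟨ ≡.cong ⟦_⟧ (ℤ.+◃n≡+n (j ℕ.* k)) ⟩
    (j ℕ.* k) · 1#          ≈⟨ ×1-homo-* j k ⟩
    j · 1# * (k · 1#)       ∎
  ⟦*⟧ (ℤ.+ j) ℤ.-[1+ k ] = begin
    ⟦ Sign.- ℤ.◃ j ℕ.* suc k ⟧   ≡⟨ ≡.cong ⟦_⟧ (ℤ.-◃n≡-n (j ℕ.* suc k)) ⟩
    ⟦ ℤ.- (ℤ.+ (j ℕ.* suc k)) ⟧  ≈⟨ ⟦-⟧ (ℤ.+ (j ℕ.* suc k)) ⟩
    - ((j ℕ.* suc k) · 1#)       ≈⟨ -‿cong (×1-homo-* j (suc k)) ⟩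
    - (j · 1# * (suc k · 1#))    ≈⟨ -‿distribʳ-* _ _ ⟩
    j · 1# * - (suc k · 1#)      ∎
  ⟦*⟧ ℤ.-[1+ j ] (ℤ.+ k) = begin
    ⟦ Sign.- ℤ.◃ suc j ℕ.* k ⟧   ≡⟨ ≡.cong ⟦_⟧ (ℤ.-◃n≡-n (suc j ℕ.* k)) ⟩
    ⟦ ℤ.- (ℤ.+ (suc j ℕ.* k)) ⟧  ≈⟨ ⟦-⟧ (ℤ.+ (suc j ℕ.* k)) ⟩
    - ((suc j ℕ.* k) · 1#)       ≈⟨ -‿cong (×1-homo-* (suc j) k) ⟩
    - (suc j · 1# * (k · 1#))    ≈⟨ -‿distribˡ-* _ _ ⟩
    - (suc j · 1#) * (k · 1#)    ∎
  ⟦*⟧ ℤ.-[1+ j ] ℤ.-[1+ k ] = begin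
    (suc j ℕ.* suc k) · 1#             ≈⟨ ×1-homo-* (suc j) (suc k) ⟩
    suc j · 1# * (suc k · 1#)          ≈⟨ -‿involutive _ ⟨
    - - (suc j · 1# * (suc k · 1#))    ≈⟨ -‿cong (-‿distribˡ-* _ _) ⟩
    - (- (suc j · 1#) * (suc k · 1#))  ≈⟨ -‿distribʳ-* _ _ ⟩
    - (suc j · 1#) * - (suc k · 1#)    ∎

  embedding : ℤ.+-*-rawRing -Raw-AlmostCommutative⟶ fromCommutativeRing R
  embedding = record
    { ⟦_⟧    = ⟦_⟧
    ; +-homo = ⟦+⟧
    ; *-homo = ⟦*⟧
    ; -‿homo = ⟦-⟧
    ; 0-homo = refl
    ; 1-homo = refl
    }

record OrderedField : Set₁ where
  infix 4 _<_ _≤_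
  field
    commutativeRing : CommutativeRing 0ℓ 0ℓ
  open CommutativeRing commutativeRing public hiding (zero; _≉_)
  field
    _<_          : Rel Carrier 0ℓ
    <-resp-≈     : ∀ {x y u v} → x ≈ u → y ≈ v → x < y → u < v
    <-irrefl     : ∀ {x} → ¬ (x < x)
    <-trans      : ∀ {x y z} → x < y → y < z → x < z
    <-connex     : ∀ x y → x < y ⊎ x ≈ y ⊎ y < x
    +-monoˡ-<    : ∀ z {x y} → x < y → x + z < y + z
    *-pos        : ∀ {x y} → 0# < x → 0# < y → 0# < x * y
    pos-inverse  : ∀ {x} → 0# < x → ∃[ y ] x * y ≈ 1#
    0<1          : 0# < 1#
    archimedean  : ∀ x {y} → 0# < y → ∃[ k ] ¬ (RawMonoid._×_ +-rawMonoid k y < x)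

  _≤_ : Rel Carrier 0ℓ
  x ≤ y = ¬ (y < x)

-- Signs and inequalities in an ordered field

module OrderedFieldProperties (𝔽 : OrderedField) where
  open OrderedField 𝔽
  open IntegerEmbedding commutativeRing using (embedding)

  private
    coeff≟ : WeaklyDecidable (Induced-equivalence embedding)
    coeff≟ i j with i ℤ.≟ j
    ... | yes ≡.refl = just refl
    ... | no  _      = nothing

  open RingSolver ℤ.+-*-rawRing (fromCommutativeRing commutativeRing) embedding coeff≟
    public using (solve; Polynomial; con; _:=_; _:+_; _:*_; :-_; _:-_)

  one : ∀ {k} → Polynomial k
  one = con (ℤ.+ 1)

  zro : ∀ {k} → Polynomial k
  zro = con (ℤ.+ 0)

  pos-resp : ∀ {x y} → x ≈ y → 0# < x → 0# < y
  pos-resp = <-resp-≈ refl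

  nonneg-resp : ∀ {x y} → x ≈ y → 0# ≤ x → 0# ≤ y
  nonneg-resp x≈y 0≤x y<0 = 0≤x (<-resp-≈ (sym x≈y) refl y<0)

  <⇒≤ : ∀ {x y} → x < y → x ≤ y
  <⇒≤ x<y y<x = <-irrefl (<-trans x<y y<x)

  ≈⇒≤ : ∀ {x y} → x ≈ y → x ≤ y
  ≈⇒≤ x≈y y<x = <-irrefl (<-resp-≈ refl x≈y y<x)

  ≤-refl : ∀ {x} → x ≤ x
  ≤-refl = <-irrefl

  nonneg-split : ∀ {x} → 0# ≤ x → 0# < x ⊎ x ≈ 0#
  nonneg-split {x} 0≤x with <-connex 0# x
  ... | inj₁ 0<x        = inj₁ 0<x
  ... | inj₂ (inj₁ 0≈x) = inj₂ (sym 0≈x)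
  ... | inj₂ (inj₂ x<0) = ⊥-elim (0≤x x<0)

  <⇒pos : ∀ {x y} → x < y → 0# < y - x
  <⇒pos {x} x<y = <-resp-≈ (-‿inverseʳ x) refl (+-monoˡ-< (- x) x<y)

  pos⇒< : ∀ {x y} → 0# < y - x → x < y
  pos⇒< {x} {y} 0<y-x = <-resp-≈ (+-identityˡ x)
    (solve 2 (λ x y → y :- x :+ x := y) refl x y) (+-monoˡ-< x 0<y-x)

  ≤⇒nonneg : ∀ {x y} → x ≤ y → 0# ≤ y - x
  ≤⇒nonneg {x} {y} x≤y y-x<0 = x≤y (<-resp-≈
    (solve 2 (λ x y → y :- x :+ x := y) refl x y) (+-identityˡ x) (+-monoˡ-< x y-x<0))

  nonneg⇒≤ : ∀ {x y} → 0# ≤ y - x → x ≤ y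
  nonneg⇒≤ {x} 0≤y-x y<x =
    0≤y-x (<-resp-≈ refl (-‿inverseʳ x) (+-monoˡ-< (- x) y<x))

  ≤0⇒nonneg : ∀ {x} → x ≤ 0# → 0# ≤ - x
  ≤0⇒nonneg {x} x≤0 = nonneg-resp (+-identityˡ (- x)) (≤⇒nonneg x≤0)

  <0⇒pos : ∀ {x} → x < 0# → 0# < - x
  <0⇒pos {x} x<0 = pos-resp (+-identityˡ (- x)) (<⇒pos x<0)

  +-pos-nonneg : ∀ {x y} → 0# < x → 0# ≤ y → 0# < x + y
  +-pos-nonneg {x} {y} 0<x 0≤y with nonneg-split 0≤y
  ... | inj₂ y≈0 = pos-resp (sym (trans (+-congˡ y≈0) (+-identityʳ x))) 0<x
  ... | inj₁ 0<y = <-trans 0<y (<-resp-≈ (+-identityˡ y) refl (+-monoˡ-< y 0<x))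

  +-pos : ∀ {x y} → 0# < x → 0# < y → 0# < x + y
  +-pos 0<x 0<y = +-pos-nonneg 0<x (<⇒≤ 0<y)

  +-nonneg : ∀ {x y} → 0# ≤ x → 0# ≤ y → 0# ≤ x + y
  +-nonneg {x} {y} 0≤x 0≤y with nonneg-split 0≤x
  ... | inj₁ 0<x = <⇒≤ (+-pos-nonneg 0<x 0≤y)
  ... | inj₂ x≈0 = nonneg-resp (sym (trans (+-congʳ x≈0) (+-identityˡ y))) 0≤y

  *-nonneg : ∀ {x y} → 0# ≤ x → 0# ≤ y → 0# ≤ x * y
  *-nonneg {x} {y} 0≤x 0≤y with nonneg-split 0≤x | nonneg-split 0≤y
  ... | inj₁ 0<x | inj₁ 0<y = <⇒≤ (*-pos 0<x 0<y)
  ... | inj₂ x≈0 | _        = ≈⇒≤ (sym (trans (*-congʳ x≈0) (zeroˡ y)))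
  ... | _        | inj₂ y≈0 = ≈⇒≤ (sym (trans (*-congˡ y≈0) (zeroʳ x)))

  pos+nonneg≉0 : ∀ {x y} → 0# < x → 0# ≤ y → ¬ (x + y ≈ 0#)
  pos+nonneg≉0 0<x 0≤y x+y≈0 = <-irrefl (pos-resp x+y≈0 (+-pos-nonneg 0<x 0≤y))

  *-cancel-pos : ∀ {x y} → 0# < x → 0# < x * y → 0# < y
  *-cancel-pos {x} {y} 0<x 0<xy with <-connex 0# y
  ... | inj₁ 0<y        = 0<y
  ... | inj₂ (inj₁ 0≈y) = ⊥-elim (<-irrefl
    (pos-resp (trans (*-congˡ (sym 0≈y)) (zeroʳ x)) 0<xy))
  ... | inj₂ (inj₂ y<0) = ⊥-elim (pos+nonneg≉0 0<xy (<⇒≤ (*-pos 0<x (<0⇒pos y<0)))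
    (solve 2 (λ x y → x :* y :+ x :* :- y := zro) refl x y))

  *-cancel-nonneg : ∀ {x y} → 0# < x → 0# ≤ x * y → 0# ≤ y
  *-cancel-nonneg {x} {y} 0<x 0≤xy y<0 = pos+nonneg≉0 (*-pos 0<x (<0⇒pos y<0)) 0≤xy
    (solve 2 (λ x y → x :* :- y :+ x :* y := zro) refl x y)

  *-cancel-zero : ∀ {x y} → 0# < x → x * y ≈ 0# → y ≈ 0#
  *-cancel-zero {x} {y} 0<x xy≈0 with <-connex 0# y
  ... | inj₁ 0<y        = ⊥-elim (<-irrefl (pos-resp xy≈0 (*-pos 0<x 0<y)))
  ... | inj₂ (inj₁ 0≈y) = sym 0≈y
  ... | inj₂ (inj₂ y<0) = ⊥-elim (pos+nonneg≉0 (*-pos 0<x (<0⇒pos y<0)) (≈⇒≤ (sym xy≈0))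
    (solve 2 (λ x y → x :* :- y :+ x :* y := zro) refl x y))

  pos-reciprocal : ∀ {x} → 0# < x → ∃[ y ] 0# < y × x * y ≈ 1#
  pos-reciprocal 0<x with y , xy≈1 ← pos-inverse 0<x =
    y , *-cancel-pos 0<x (pos-resp (sym xy≈1) 0<1) , xy≈1

  ≈-from-difference : ∀ {x y} → x - y ≈ 0# → x ≈ y
  ≈-from-difference {x} {y} x-y≈0 = trans
    (solve 2 (λ x y → x := x :- y :+ y) refl x y)
    (trans (+-congʳ x-y≈0) (+-identityˡ y))

  square-nonneg : ∀ x → 0# ≤ x * x
  square-nonneg x with <-connex 0# x
  ... | inj₁ 0<x        = <⇒≤ (*-pos 0<x 0<x)
  ... | inj₂ (inj₁ 0≈x) = ≈⇒≤ (sym (trans (*-congˡ (sym 0≈x)) (zeroʳ x)))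
  ... | inj₂ (inj₂ x<0) = <⇒≤ (pos-resp
    (solve 1 (λ x → :- x :* :- x := x :* x) refl x) (*-pos (<0⇒pos x<0) (<0⇒pos x<0)))

  half : ∀ {x} → 0# < x → ∃[ h ] 0# < h × h + h ≈ x
  half {x} 0<x with i , 0<i , 2i≈1 ← pos-reciprocal (+-pos 0<1 0<1) =
    i * x , *-pos 0<i 0<x ,
    trans (solve 2 (λ i x → i :* x :+ i :* x := (one :+ one) :* i :* x) refl i x)
          (trans (*-congʳ 2i≈1) (*-identityˡ x))

-- Affine geometry of the plane

module PlaneGeometry (𝔽 : OrderedField) where
  open OrderedField 𝔽
  open OrderedFieldProperties 𝔽

  infix 4 _≋_
  infix 9 _at_

  Point : Set
  Point = Carrier × Carrier

  _≋_ : Rel Point 0ℓ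
  (x₁ , y₁) ≋ (x₂ , y₂) = x₁ ≈ x₂ × y₁ ≈ y₂

  ≋-sym : ∀ {p q} → p ≋ q → q ≋ p
  ≋-sym (x≈ , y≈) = sym x≈ , sym y≈

  mix : Carrier → Point → Point → Point
  mix t (x₁ , y₁) (x₂ , y₂) = (1# - t) * x₁ + t * x₂ , (1# - t) * y₁ + t * y₂

  -- The records without η stop the unifier from unfolding points and functionals.
  record Affine : Set where
    no-eta-equality
    pattern
    constructor affine
    field
      slope₁ slope₂ offset : Carrier

  _at_ : Affine → Point → Carrier
  affine u v w at (x , y) = u * x + v * y + w

  at-cong : ∀ φ {p q} → p ≋ q → φ at p ≈ φ at q
  at-cong (affine u v w) (x≈ , y≈) = +-congʳ (+-cong (*-congˡ x≈) (*-congˡ y≈))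

  at-mix : ∀ φ t p q → φ at (mix t p q) ≈ (1# - t) * φ at p + t * φ at q
  at-mix (affine u v w) t (x₁ , y₁) (x₂ , y₂) = solve 8
    (λ u v w t x₁ y₁ x₂ y₂ →
      u :* ((one :- t) :* x₁ :+ t :* x₂) :+ v :* ((one :- t) :* y₁ :+ t :* y₂) :+ w :=
      (one :- t) :* (u :* x₁ :+ v :* y₁ :+ w) :+ t :* (u :* x₂ :+ v :* y₂ :+ w))
    refl u v w t x₁ y₁ x₂ y₂

  -- Quantifying over all affine functionals gives the value of any of them at r by one application,
  -- without coordinates. Nothing is lost, because these values determine the point
  -- (`affine-separated`).
  record segment (p q r : Point) : Set where
    no-eta-equality
    pattern
    constructor between
    field
      weight       : Carrier
      0≤weight     : 0# ≤ weight
      0≤coweight   : 0# ≤ 1# - weight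
      at-segment   : ∀ φ → φ at r ≈ (1# - weight) * φ at p + weight * φ at q

  negate : Affine → Affine
  negate (affine u v w) = affine (- u) (- v) (- w)

  at-negate : ∀ φ p → negate φ at p ≈ - (φ at p)
  at-negate (affine u v w) (x , y) = solve 5
    (λ u v w x y → :- u :* x :+ :- v :* y :+ :- w := :- (u :* x :+ v :* y :+ w))
    refl u v w x y

  coord₁ coord₂ : Affine
  coord₁ = affine 1# 0# 0#
  coord₂ = affine 0# 1# 0#

  at-coord₁ : ∀ p → coord₁ at p ≈ proj₁ p
  at-coord₁ (x , y) = solve 2 (λ x y → one :* x :+ zro :* y :+ zro := x) refl x y

  at-coord₂ : ∀ p → coord₂ at p ≈ proj₂ p
  at-coord₂ (x , y) = solve 2 (λ x y → zro :* x :+ one :* y :+ zro := y) refl x y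

  affine-separated : ∀ {p q} → (∀ φ → φ at p ≈ φ at q) → p ≋ q
  affine-separated {p} {q} same =
    trans (sym (at-coord₁ p)) (trans (same coord₁) (at-coord₁ q)) ,
    trans (sym (at-coord₂ p)) (trans (same coord₂) (at-coord₂ q))

  mix⇒segment : ∀ p q r → ∃[ t ] 0# ≤ t × t ≤ 1# × r ≋ mix t p q → segment p q r
  mix⇒segment p q r (t , 0≤t , t≤1 , r≋) =
    between t 0≤t (≤⇒nonneg t≤1) (λ φ → trans (at-cong φ r≋) (at-mix φ t p q))

  segment⇒mix : ∀ {p q r} → segment p q r → ∃[ t ] 0# ≤ t × t ≤ 1# × r ≋ mix t p q
  segment⇒mix {p} {q} (between t 0≤t 0≤1-t at-r) =
    t , 0≤t , nonneg⇒≤ 0≤1-t , affine-separated (λ φ → trans (at-r φ) (sym (at-mix φ t p q)))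

  segment-resp : ∀ {p q r r′} → r ≋ r′ → r ∈ segment p q → r′ ∈ segment p q
  segment-resp r≋r′ r∈ with between t 0≤t 0≤1-t at-r ← r∈ =
    between t 0≤t 0≤1-t (λ φ → trans (at-cong φ (≋-sym r≋r′)) (at-r φ))

  segment-sym : ∀ {p q r} → r ∈ segment p q → r ∈ segment q p
  segment-sym {p} {q} r∈ with between t 0≤t 0≤1-t at-r ← r∈ =
    between (1# - t) 0≤1-t
      (nonneg-resp (solve 1 (λ t → t := one :- (one :- t)) refl t) 0≤t)
      (λ φ → trans (at-r φ) (solve 3
        (λ t x y → (one :- t) :* x :+ t :* y := (one :- (one :- t)) :* y :+ (one :- t) :* x)
        refl t (φ at p) (φ at q)))

  start∈segment : ∀ p q → p ∈ segment p q
  start∈segment p q = between 0# ≤-refl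
    (nonneg-resp (solve 0 (one := one :- zro) refl) (<⇒≤ 0<1))
    (λ φ → solve 2 (λ x y → x := (one :- zro) :* x :+ zro :* y) refl (φ at p) (φ at q))

  subsegment : ∀ {p q r s} → r ∈ segment p q → s ∈ segment r q → s ∈ segment p q
  subsegment {p} {q} r∈ s∈
    with between t 0≤t 0≤1-t at-r ← r∈
       | between u 0≤u 0≤1-u at-s ← s∈ =
    between (t + (1# - t) * u) (+-nonneg 0≤t (*-nonneg 0≤1-t 0≤u))
      (nonneg-resp (solve 2 (λ t u → (one :- t) :* (one :- u) := one :- (t :+ (one :- t) :* u))
        refl t u) (*-nonneg 0≤1-t 0≤1-u))
      (λ φ → trans (at-s φ) (trans (+-congʳ (*-congˡ (at-r φ))) (solve 4
        (λ t u x y → (one :- u) :* ((one :- t) :* x :+ t :* y) :+ u :* y :=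
          (one :- (t :+ (one :- t) :* u)) :* x :+ (t :+ (one :- t) :* u) :* y)
        refl t u (φ at p) (φ at q))))

  -- The weight is φ(p) / (φ(p) - φ(q)). If the denominator vanishes, the sign conditions force φ(p)
  -- = 0 and p itself serves.
  zero-between : ∀ φ p q → 0# ≤ φ at p → φ at q ≤ 0# →
    ∃[ r ] r ∈ segment p q × φ at r ≈ 0#
  zero-between φ p q 0≤φp φq≤0
    with nonneg-split (+-nonneg 0≤φp (≤0⇒nonneg φq≤0))
  ... | inj₁ 0<φp-φq with i , 0<i , gap*i≈1 ← pos-reciprocal 0<φp-φq =
    let t = i * φ at p
        1-t≈ = trans (+-congʳ (sym gap*i≈1)) (solve 3
          (λ i x y → (x :- y) :* i :- i :* x := i :* :- y) refl i (φ at p) (φ at q))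
        r∈ = between t (*-nonneg (<⇒≤ 0<i) 0≤φp)
               (nonneg-resp (sym 1-t≈) (*-nonneg (<⇒≤ 0<i) (≤0⇒nonneg φq≤0)))
               (λ ψ → at-mix ψ t p q)
    in mix t p q , r∈ , trans (at-mix φ t p q) (trans (+-congʳ (*-congʳ 1-t≈))
         (solve 3 (λ i x y → i :* :- y :* x :+ i :* x :* y := zro)
           refl i (φ at p) (φ at q)))
  ... | inj₂ φp-φq≈0 = p , start∈segment p q , φp≈0
    where
    φp≈0 : φ at p ≈ 0#
    φp≈0 with nonneg-split 0≤φp
    ... | inj₂ φp≈0 = φp≈0
    ... | inj₁ 0<φp = ⊥-elim (pos+nonneg≉0 0<φp (≤0⇒nonneg φq≤0) φp-φq≈0)

  at-segment-nonneg : ∀ φ {p q r} → 0# ≤ φ at p → 0# ≤ φ at q → r ∈ segment p q → 0# ≤ φ at r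
  at-segment-nonneg φ 0≤φp 0≤φq r∈ with between t 0≤t 0≤1-t at-r ← r∈ =
    nonneg-resp (sym (at-r φ)) (+-nonneg (*-nonneg 0≤1-t 0≤φp) (*-nonneg 0≤t 0≤φq))

  record Barycentric (e a f : Point) : Set where
    field
      α β γ  : Affine
      sum≈1  : ∀ p → α at p + β at p + γ at p ≈ 1#
      expand : ∀ φ p → φ at p ≈ α at p * φ at e + β at p * φ at a + γ at p * φ at f
      α-a    : α at a ≈ 0#
      α-f    : α at f ≈ 0#
      β-e    : β at e ≈ 0#
      β-a    : β at a ≈ 1#
      β-f    : β at f ≈ 0#
      γ-e    : γ at e ≈ 0#
      γ-a    : γ at a ≈ 0#

  -- Twice the signed area of the triangle e a f.
  cross : Point → Point → Point → Carrier
  cross (ex , ey) (ax , ay) (fx , fy) = (ax - ex) * (fy - ey) - (ay - ey) * (fx - ex)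

  -- As a function of p, `line q r at p` is `cross q r p`.
  line : Point → Point → Affine
  line (qx , qy) (rx , ry) = affine (qy - ry) (rx - qx) (qx * ry - qy * rx)

  line-start : ∀ q r → line q r at q ≈ 0#
  line-start (qx , qy) (rx , ry) = solve 4 (λ qx qy rx ry →
    (qy :- ry) :* qx :+ (rx :- qx) :* qy :+ (qx :* ry :- qy :* rx) := zro)
    refl qx qy rx ry

  line-end : ∀ q r → line q r at r ≈ 0#
  line-end (qx , qy) (rx , ry) = solve 4 (λ qx qy rx ry →
    (qy :- ry) :* rx :+ (rx :- qx) :* ry :+ (qx :* ry :- qy :* rx) := zro)
    refl qx qy rx ry

  line-apex : ∀ e a f → line f e at a ≈ cross e a f
  line-apex (ex , ey) (ax , ay) (fx , fy) = solve 6 (λ ex ey ax ay fx fy →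
    (fy :- ey) :* ax :+ (ex :- fx) :* ay :+ (fx :* ey :- fy :* ex) :=
    (ax :- ex) :* (fy :- ey) :- (ay :- ey) :* (fx :- ex))
    refl ex ey ax ay fx fy

  -- The three terms are twice the signed areas of the triangles that p spans with the sides of e a
  -- f.
  lines-sum : ∀ e a f p → line a f at p + line f e at p + line e a at p ≈ cross e a f
  lines-sum (ex , ey) (ax , ay) (fx , fy) (px , py) = solve 8 (λ px py ex ey ax ay fx fy →
    (ay :- fy) :* px :+ (fx :- ax) :* py :+ (ax :* fy :- ay :* fx) :+
    ((fy :- ey) :* px :+ (ex :- fx) :* py :+ (fx :* ey :- fy :* ex)) :+
    ((ey :- ay) :* px :+ (ax :- ex) :* py :+ (ex :* ay :- ey :* ax)) :=
    (ax :- ex) :* (fy :- ey) :- (ay :- ey) :* (fx :- ex))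
    refl px py ex ey ax ay fx fy

  lines-coord₁ : ∀ e a f p → line a f at p * proj₁ e + line f e at p * proj₁ a +
    line e a at p * proj₁ f ≈ cross e a f * proj₁ p
  lines-coord₁ (ex , ey) (ax , ay) (fx , fy) (px , py) = solve 8 (λ px py ex ey ax ay fx fy →
    ((ay :- fy) :* px :+ (fx :- ax) :* py :+ (ax :* fy :- ay :* fx)) :* ex :+
    ((fy :- ey) :* px :+ (ex :- fx) :* py :+ (fx :* ey :- fy :* ex)) :* ax :+
    ((ey :- ay) :* px :+ (ax :- ex) :* py :+ (ex :* ay :- ey :* ax)) :* fx :=
    ((ax :- ex) :* (fy :- ey) :- (ay :- ey) :* (fx :- ex)) :* px)
    refl px py ex ey ax ay fx fy

  lines-coord₂ : ∀ e a f p → line a f at p * proj₂ e + line f e at p * proj₂ a +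
    line e a at p * proj₂ f ≈ cross e a f * proj₂ p
  lines-coord₂ (ex , ey) (ax , ay) (fx , fy) (px , py) = solve 8 (λ px py ex ey ax ay fx fy →
    ((ay :- fy) :* px :+ (fx :- ax) :* py :+ (ax :* fy :- ay :* fx)) :* ey :+
    ((fy :- ey) :* px :+ (ex :- fx) :* py :+ (fx :* ey :- fy :* ex)) :* ay :+
    ((ey :- ay) :* px :+ (ax :- ex) :* py :+ (ex :* ay :- ey :* ax)) :* fy :=
    ((ax :- ex) :* (fy :- ey) :- (ay :- ey) :* (fx :- ex)) :* py)
    refl px py ex ey ax ay fx fy

  -- Cramer's rule before division. An affine functional is a combination of the two coordinates and
  -- the constant 1, for which the identity is `lines-coord₁`, `lines-coord₂` and `lines-sum`.
  lines-expand : ∀ e a f φ p → line a f at p * φ at e + line f e at p * φ at a +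
    line e a at p * φ at f ≈ cross e a f * φ at p
  lines-expand e a f (affine u v w) p = trans
    (solve 12 (λ α β γ u v w ex ey ax ay fx fy →
      α :* (u :* ex :+ v :* ey :+ w) :+ β :* (u :* ax :+ v :* ay :+ w) :+
        γ :* (u :* fx :+ v :* fy :+ w) :=
      u :* (α :* ex :+ β :* ax :+ γ :* fx) :+ v :* (α :* ey :+ β :* ay :+ γ :* fy) :+
        w :* (α :+ β :+ γ))
      refl (line a f at p) (line f e at p) (line e a at p) u v w
      (proj₁ e) (proj₂ e) (proj₁ a) (proj₂ a) (proj₁ f) (proj₂ f))
    (trans (+-cong (+-cong (*-congˡ (lines-coord₁ e a f p)) (*-congˡ (lines-coord₂ e a f p)))
                   (*-congˡ (lines-sum e a f p)))
      (solve 6 (λ D u v w x y → u :* (D :* x) :+ v :* (D :* y) :+ w :* D :=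
        D :* (u :* x :+ v :* y :+ w)) refl (cross e a f) u v w (proj₁ p) (proj₂ p)))

  scale : Carrier → Affine → Affine
  scale i (affine u v w) = affine (i * u) (i * v) (i * w)

  at-scale : ∀ i φ p → scale i φ at p ≈ i * φ at p
  at-scale i (affine u v w) (x , y) = solve 6
    (λ i u v w x y → i :* u :* x :+ i :* v :* y :+ i :* w := i :* (u :* x :+ v :* y :+ w))
    refl i u v w x y

  barycentric : ∀ e a f → ¬ (cross e a f ≈ 0#) → Barycentric e a f
  barycentric e a f D≉0 = record
    { α      = scale i (line a f)
    ; β      = scale i (line f e)
    ; γ      = scale i (line e a)
    ; sum≈1  = λ p → trans
        (+-cong (+-cong (at-scale i (line a f) p) (at-scale i (line f e) p))
                (at-scale i (line e a) p))
        (trans (solve 4 (λ i x y z → i :* x :+ i :* y :+ i :* z := (x :+ y :+ z) :* i)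
                 refl i (line a f at p) (line f e at p) (line e a at p))
               (trans (*-congʳ (lines-sum e a f p)) D*i≈1))
    ; expand = λ φ p → sym (trans
        (+-cong (+-cong (*-congʳ (at-scale i (line a f) p)) (*-congʳ (at-scale i (line f e) p)))
                (*-congʳ (at-scale i (line e a) p)))
        (trans (solve 7 (λ i x y z u v w →
                   i :* x :* u :+ i :* y :* v :+ i :* z :* w := (x :* u :+ y :* v :+ z :* w) :* i)
                 refl i (line a f at p) (line f e at p) (line e a at p) (φ at e) (φ at a) (φ at f))
        (trans (*-congʳ (lines-expand e a f φ p))
        (trans (solve 3 (λ D x i → D :* x :* i := D :* i :* x) refl (cross e a f) (φ at p) i)
        (trans (*-congʳ D*i≈1) (*-identityˡ _))))))
    ; α-a    = vanish (line a f) (line-start a f)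
    ; α-f    = vanish (line a f) (line-end a f)
    ; β-e    = vanish (line f e) (line-end f e)
    ; β-a    = trans (at-scale i (line f e) a)
        (trans (*-congˡ (line-apex e a f)) (trans (*-comm _ _) D*i≈1))
    ; β-f    = vanish (line f e) (line-start f e)
    ; γ-e    = vanish (line e a) (line-start e a)
    ; γ-a    = vanish (line e a) (line-end e a)
    }
    where
    reciprocal : ∃[ i ] cross e a f * i ≈ 1#
    reciprocal with <-connex 0# (cross e a f)
    ... | inj₁ 0<D        = pos-inverse 0<D
    ... | inj₂ (inj₁ 0≈D) = ⊥-elim (D≉0 (sym 0≈D))
    ... | inj₂ (inj₂ D<0) with j , -D*j≈1 ← pos-inverse (<0⇒pos D<0) =
      - j , trans (solve 2 (λ D j → D :* :- j := :- D :* j) refl (cross e a f) j) -D*j≈1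

    i : Carrier
    i = proj₁ reciprocal

    D*i≈1 : cross e a f * i ≈ 1#
    D*i≈1 = proj₂ reciprocal

    vanish : ∀ φ {p} → φ at p ≈ 0# → scale i φ at p ≈ 0#
    vanish φ {p} φp≈0 = trans (at-scale i φ p) (trans (*-congˡ φp≈0) (zeroʳ i))

  -- When the `cross` term vanishes, this says that ψ(a) is interpolated between ψ(e) and ψ(f) with
  -- the weights that φ prescribes. Keeping that term makes it a polynomial identity, which the
  -- solver can check.
  cross-relation : ∀ φ ψ e a f → (φ at e - φ at f) * ψ at a ≈
    - (φ at f) * ψ at e + φ at e * ψ at f +
    (cross e a f * (Affine.slope₂ ψ * Affine.slope₁ φ - Affine.slope₁ ψ * Affine.slope₂ φ) +
     φ at a * (ψ at e - ψ at f))
  cross-relation (affine u v w) (affine k l m) (ex , ey) (ax , ay) (fx , fy) =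
    solve 12 (λ ex ey ax ay fx fy u v w k l m →
      let φe = u :* ex :+ v :* ey :+ w
          φa = u :* ax :+ v :* ay :+ w
          φf = u :* fx :+ v :* fy :+ w
          ψe = k :* ex :+ l :* ey :+ m
          ψa = k :* ax :+ l :* ay :+ m
          ψf = k :* fx :+ l :* fy :+ m
      in (φe :- φf) :* ψa := :- φf :* ψe :+ φe :* ψf :+
         (((ax :- ex) :* (fy :- ey) :- (ay :- ey) :* (fx :- ex)) :* (l :* u :- k :* v) :+
          φa :* (ψe :- ψf)))
      refl ex ey ax ay fx fy u v w k l m

  -- Since φ separates e from f, it parametrises their line: the weight of p is (φ(e) - φ(p)) /
  -- (φ(e) - φ(f)).
  collinear-between : ∀ φ {e p f} → φ at f < φ at e → φ at f ≤ φ at p → φ at p ≤ φ at e →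
    cross e p f ≈ 0# → segment e f p
  collinear-between φ {e} {p} {f} φf<φe φf≤φp φp≤φe D≈0
    with i , 0<i , gap*i≈1 ← pos-reciprocal (<⇒pos φf<φe) =
    between (i * (φ at e - φ at p)) (*-nonneg (<⇒≤ 0<i) (≤⇒nonneg φp≤φe))
      (nonneg-resp (sym coweight≈) (*-nonneg (<⇒≤ 0<i) (≤⇒nonneg φf≤φp)))
      λ ψ → trans (sym (*-identityˡ _)) (trans (*-congʳ (sym gap*i≈1))
        (trans (solve 3 (λ g i x → g :* i :* x := i :* (g :* x)) refl _ i _)
        (trans (*-congˡ (trans (cross-relation φ ψ e p f)
          (+-congˡ (trans (+-congʳ (trans (*-congʳ D≈0) (zeroˡ _))) (+-identityˡ _)))))
        (trans (solve 6 (λ i x y z u v → i :* (:- y :* u :+ x :* v :+ z :* (u :- v)) :=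
                   i :* (z :- y) :* u :+ i :* (x :- z) :* v)
                   refl i (φ at e) (φ at f) (φ at p) (ψ at e) (ψ at f))
               (+-congʳ (*-congʳ (sym coweight≈)))))))
    where
    coweight≈ : 1# - i * (φ at e - φ at p) ≈ i * (φ at p - φ at f)
    coweight≈ = trans (+-congʳ (sym gap*i≈1)) (solve 4
      (λ i x y z → (x :- y) :* i :- i :* (x :- z) := i :* (z :- y))
      refl i (φ at e) (φ at f) (φ at p))

-- Compactness: attained minima and uniform bounds

module PlaneCompactness (𝔽 : OrderedField) (em : ExcludedMiddle 0ℓ) where
  open OrderedField 𝔽
  open OrderedFieldProperties 𝔽
  open PlaneGeometry 𝔽

  ≤-trans : ∀ {x y z} → x ≤ y → y ≤ z → x ≤ z
  ≤-trans {x} {y} {z} x≤y y≤z = nonneg⇒≤ (nonneg-resp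
    (solve 3 (λ x y z → y :- x :+ (z :- y) := z :- x) refl x y z)
    (+-nonneg (≤⇒nonneg x≤y) (≤⇒nonneg y≤z)))

  <-≤-trans : ∀ {x y z} → x < y → y ≤ z → x < z
  <-≤-trans {x} {y} {z} x<y y≤z = pos⇒< (pos-resp
    (solve 3 (λ x y z → y :- x :+ (z :- y) := z :- x) refl x y z)
    (+-pos-nonneg (<⇒pos x<y) (≤⇒nonneg y≤z)))

  ≤-total : ∀ x y → x ≤ y ⊎ y ≤ x
  ≤-total x y with <-connex x y
  ... | inj₁ x<y        = inj₁ (<⇒≤ x<y)
  ... | inj₂ (inj₁ x≈y) = inj₁ (≈⇒≤ x≈y)
  ... | inj₂ (inj₂ y<x) = inj₂ (<⇒≤ y<x)

  -- Distance below r in the maximum norm. Four linear inequalities avoid absolute values and square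
  -- roots.
  record Near (r : Carrier) (p q : Point) : Set where
    no-eta-equality
    pattern
    constructor near
    field
      x< : proj₁ p - proj₁ q < r
      x> : proj₁ q - proj₁ p < r
      y< : proj₂ p - proj₂ q < r
      y> : proj₂ q - proj₂ p < r

  near-sym : ∀ {r p q} → Near r p q → Near r q p
  near-sym (near x< x> y< y>) = near x> x< y> y<

  near-mono : ∀ {r s p q} → r ≤ s → Near r p q → Near s p q
  near-mono r≤s (near x< x> y< y>) =
    near (<-≤-trans x< r≤s) (<-≤-trans x> r≤s) (<-≤-trans y< r≤s) (<-≤-trans y> r≤s)

  near-trans : ∀ {r s p q u} → Near r p q → Near s q u → Near (r + s) p u
  near-trans {r} {s} (near a b c d) (near a′ b′ c′ d′) =
    near (add a a′) (<-resp-≈ refl (+-comm s r) (add b′ b))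
         (add c c′) (<-resp-≈ refl (+-comm s r) (add d′ d))
    where
    add : ∀ {x y z r s} → x - y < r → y - z < s → x - z < r + s
    add {x} {y} {z} {r} {s} x-y<r y-z<s = pos⇒< (pos-resp
      (solve 5 (λ x y z r s → r :- (x :- y) :+ (s :- (y :- z)) := r :+ s :- (x :- z))
        refl x y z r s)
      (+-pos (<⇒pos x-y<r) (<⇒pos y-z<s)))

  -- The bound k = x² + 2 exceeds |x| because 2(k - x) = x² + (x - 1)² + 3, and likewise for k + x.
  bounding : ∀ x → ∃[ k ] 0# < k × 0# < k - x × 0# < k + x
  bounding x = x * x + 1# + 1# ,
    +-pos (+-pos-nonneg′ (square-nonneg x) 0<1) 0<1 ,
    *-cancel-pos (+-pos 0<1 0<1) (pos-resp
      (solve 1 (λ x → x :* x :+ ((x :- one) :* (x :- one) :+ (one :+ one :+ one)) :=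
        (one :+ one) :* (x :* x :+ one :+ one :- x)) refl x) (squares (x - 1#))) ,
    *-cancel-pos (+-pos 0<1 0<1) (pos-resp
      (solve 1 (λ x → x :* x :+ ((x :+ one) :* (x :+ one) :+ (one :+ one :+ one)) :=
        (one :+ one) :* (x :* x :+ one :+ one :+ x)) refl x) (squares (x + 1#)))
    where
    +-pos-nonneg′ : ∀ {x y} → 0# ≤ x → 0# < y → 0# < x + y
    +-pos-nonneg′ {x} {y} 0≤x 0<y = pos-resp (+-comm y x) (+-pos-nonneg 0<y 0≤x)
    squares : ∀ y → 0# < x * x + (y * y + (1# + 1# + 1#))
    squares y = +-pos-nonneg′ (square-nonneg x)
      (+-pos-nonneg′ (square-nonneg y) (+-pos (+-pos 0<1 0<1) 0<1))

  -- With k > |u| and l > |v| the radius ε / (k + l) suffices. Only the lower bound on φ(q) is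
  -- stated; the upper one is this lemma for `negate φ`.
  at-continuous : ∀ φ p {ε} → 0# < ε →
    ∃[ r ] 0# < r × (∀ q → Near r p q → 0# < φ at q - φ at p + ε)
  at-continuous (affine u v w) (px , py) {ε} 0<ε =
    let k , 0<k , 0<k-u , 0<k+u = bounding u
        l , 0<l , 0<l-v , 0<l+v = bounding v
        i , 0<i , k+l*i≈1 = pos-reciprocal (+-pos 0<k 0<l)
    in i * ε , *-pos 0<i 0<ε , λ { (qx , qy) (near x< x> y< y>) → pos-resp
      (trans (solve 10 (λ k l u v w px py qx qy r →
          u :* (qx :- px) :+ k :* r :+ (v :* (qy :- py) :+ l :* r) :=
          u :* qx :+ v :* qy :+ w :- (u :* px :+ v :* py :+ w) :+ (k :+ l) :* r)
          refl k l u v w px py qx qy (i * ε))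
        (+-congˡ (trans (sym (*-assoc _ i ε)) (trans (*-congʳ k+l*i≈1) (*-identityˡ ε)))))
      (+-pos (slope-bound u k px qx _ 0<k-u 0<k+u x< x>)
             (slope-bound v l py qy _ 0<l-v 0<l+v y< y>)) }
    where
    slope-bound : ∀ u k x y r → 0# < k - u → 0# < k + u → x - y < r → y - x < r →
      0# < u * (y - x) + k * r
    slope-bound u k x y r 0<k-u 0<k+u x-y<r y-x<r = *-cancel-pos (+-pos 0<1 0<1) (pos-resp
      (solve 5 (λ u k x y r →
        (k :- u) :* (r :- (y :- x)) :+ (k :+ u) :* (r :- (x :- y)) :=
        (one :+ one) :* (u :* (y :- x) :+ k :* r)) refl u k x y r)
      (+-pos (*-pos 0<k-u (<⇒pos y-x<r)) (*-pos 0<k+u (<⇒pos x-y<r))))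

  -- The condition holds for all sufficiently small positive s. Finitely many such conditions have a
  -- common s, and the tolerance of the descent is found in this way.
  Eventually : (Carrier → Set) → Set
  Eventually P = ∃[ r ] 0# < r × (∀ s → 0# < s → s ≤ r → P s)

  lower-bound : ∀ {x y} → 0# < x → 0# < y → ∃[ z ] 0# < z × z ≤ x × z ≤ y
  lower-bound {x} {y} 0<x 0<y with ≤-total x y
  ... | inj₁ x≤y = x , 0<x , ≤-refl , x≤y
  ... | inj₂ y≤x = y , 0<y , y≤x , ≤-refl

  eventually-× : ∀ P Q → Eventually P → Eventually Q → Eventually (λ s → P s × Q s)
  eventually-× P Q (r , 0<r , Pr) (s , 0<s , Qs) with t , 0<t , t≤r , t≤s ← lower-bound 0<r 0<s =
    t , 0<t , λ u 0<u u≤t → Pr u 0<u (≤-trans u≤t t≤r) , Qs u 0<u (≤-trans u≤t t≤s)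

  eventually-Fin : ∀ {n} (P : Fin n → Carrier → Set) →
    (∀ i → Eventually (P i)) → Eventually (λ s → ∀ i → P i s)
  eventually-Fin {ℕ.zero}  P each = 1# , 0<1 , λ _ _ _ ()
  eventually-Fin {ℕ.suc n} P each =
    let r , 0<r , both = eventually-× (P zero) (λ s → ∀ i → P (suc i) s) (each zero)
                            (eventually-Fin (λ i → P (suc i)) (λ i → each (suc i)))
    in r , 0<r , λ s 0<s s≤r → split s (both s 0<s s≤r)
    where
    split : ∀ s → P zero s × (∀ i → P (suc i) s) → ∀ i → P i s
    split s (P₀ , P₊) zero    = P₀
    split s (P₀ , P₊) (suc i) = P₊ i

  -- Compactness in the form in which it is applied: the P i are arbitrary predicates that hold
  -- locally, so that no open sets have to be constructed at each use.
  HasSubcovers : Pred Point 0ℓ → Set₁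
  HasSubcovers S = ∀ {I : Set} (P : I → Point → Set) →
    (∀ p → S p → ∃[ i ] ∃[ r ] 0# < r × (∀ q → Near r p q → P i q)) →
    ∃[ is ] (∀ p → S p → Any (λ i → P i p) is)

  near-refl : ∀ {r} p → 0# < r → Near r p p
  near-refl p 0<r = near (self (proj₁ p)) (self (proj₁ p)) (self (proj₂ p)) (self (proj₂ p))
    where self = λ x → <-resp-≈ (sym (-‿inverseʳ x)) refl 0<r

  near-half : ∀ {h d r s p q u} → h + h ≈ d → r ≤ h → s ≤ h → Near r p q → Near s q u → Near d p u
  near-half {h} {d} h+h≈d r≤h s≤h p~q q~u = near-mono {h + h} (≈⇒≤ h+h≈d)
    (near-trans (near-mono r≤h p~q) (near-mono s≤h q~u))

  dist² : Point → Point → Carrier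
  dist² (x₁ , y₁) (x₂ , y₂) = (x₁ - x₂) * (x₁ - x₂) + (y₁ - y₂) * (y₁ - y₂)

  disc⇒near : ∀ p q {r} → 0# < r → dist² p q < r * r → Near r p q
  disc⇒near (x₁ , y₁) (x₂ , y₂) {r} 0<r d²<r² = near
    (leg refl) (leg (+-congʳ (square-sym x₁ x₂)))
    (leg (+-comm _ _)) (leg (trans (+-congˡ (square-sym y₁ y₂)) (+-comm _ _)))
    where
    square-sym : ∀ x y → (x - y) * (x - y) ≈ (y - x) * (y - x)
    square-sym = solve 2 (λ x y → (x :- y) :* (x :- y) := (y :- x) :* (y :- x)) refl

    -- Here u is one signed coordinate difference and v the other: u ≥ r would give u² + v² ≥ r².
    leg : ∀ {u v} → (x₁ - x₂) * (x₁ - x₂) + (y₁ - y₂) * (y₁ - y₂) ≈ u * u + v * v → u < r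
    leg {u} {v} d²≈ = decidable-stable em λ u≮r → pos+nonneg≉0 (<⇒pos d²<r²)
      (+-nonneg (*-nonneg (≤⇒nonneg u≮r) (+-nonneg (≤⇒nonneg u≮r) (+-nonneg (<⇒≤ 0<r) (<⇒≤ 0<r))))
                (square-nonneg v))
      (trans (+-congʳ (+-congˡ (-‿cong d²≈)))
        (solve 3 (λ u v r → r :* r :- (u :* u :+ v :* v) :+
          ((u :- r) :* (u :- r :+ (r :+ r)) :+ v :* v) := zro) refl u v r))

  Open : Pred Point 0ℓ → Set
  Open U = ∀ {p} → p ∈ U → ∃[ r ] 0# < r × (∀ q → dist² p q < r * r → q ∈ U)

  Compact : Pred Point 0ℓ → Set₁
  Compact S = ∀ {I : Set} (U : I → Pred Point 0ℓ) → (∀ i → Open (U i)) →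
    (∀ {p} → p ∈ S → ∃[ i ] p ∈ U i) →
    ∃[ is ] (∀ {p} → p ∈ S → Any (λ i → p ∈ U i) is)

  -- The interiors of the P i in the maximum norm form the open cover. They are open for the
  -- Euclidean distance, because every point of a disc of half the radius keeps a square
  -- neighbourhood of half the radius.
  compact⇒subcovers : ∀ {S} → Compact S → HasSubcovers S
  compact⇒subcovers {S} compact {I} P local =
    let is , covers = compact Interior interior-open (λ {p} → local p)
    in is , λ p p∈S → Any.map (λ (r , 0<r , inside) → inside p (near-refl p 0<r)) (covers p∈S)
    where
    Interior : I → Pred Point 0ℓ
    Interior i p = ∃[ r ] 0# < r × (∀ q → Near r p q → P i q)

    interior-open : ∀ i → Open (Interior i)
    interior-open i {p} (r , 0<r , inside) =
      let h , 0<h , h+h≈r = half 0<r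
      in h , 0<h , λ q d²<h² → h , 0<h , λ u q~u →
           inside u (near-half h+h≈r ≤-refl ≤-refl (disc⇒near p q 0<h d²<h²) q~u)

  -- The cover is indexed by the local radii themselves, so the least radius of a finite subcover is
  -- a uniform one.
  eventually-on-compact : ∀ {S} (P : Carrier → Point → Set) → HasSubcovers S →
    (∀ p → S p → ∃[ r ] 0# < r × (∀ q → Near r p q → ∀ s → 0# < s → s ≤ r → P s q)) →
    Eventually (λ s → ∀ p → S p → P s p)
  eventually-on-compact {S} P subcovers local =
    let radii , covers = subcovers {∃[ r ] 0# < r} (λ (r , _) q → ∀ s → 0# < s → s ≤ r → P s q)
          (λ p p∈S → let r , 0<r , close = local p p∈S in (r , 0<r) , r , 0<r , close)
        z , 0<z , z≤ = minimum radii
    in z , 0<z , λ s 0<s s≤z p p∈S →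
       pick z≤ (covers p p∈S) s≤z 0<s
    where
    minimum : (rs : List (∃[ r ] 0# < r)) → ∃[ z ] 0# < z × All (λ (r , _) → z ≤ r) rs
    minimum []              = 1# , 0<1 , []
    minimum ((r , 0<r) ∷ rs) with z , 0<z , z≤rs ← minimum rs
                             with m , 0<m , m≤r , m≤z ← lower-bound 0<r 0<z =
      m , 0<m , m≤r ∷ All.map (≤-trans m≤z) z≤rs
    pick : ∀ {rs : List (∃[ r ] 0# < r)} {z s p} → All (λ (r , _) → z ≤ r) rs →
      Any (λ (r , _) → ∀ s → 0# < s → s ≤ r → P s p) rs → s ≤ z → 0# < s → P s p
    pick (z≤r ∷ _) (here Pr) s≤z 0<s = Pr _ 0<s (≤-trans s≤z z≤r)
    pick (_ ∷ z≤) (there h) s≤z 0<s = pick z≤ h s≤z 0<s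

  InPolygon : List Affine → Point → Set
  InPolygon ψs p = All (λ ψ → 0# ≤ ψ at p) ψs

  -- Without a minimum, each feasible point has a feasible m of smaller value, and φ stays above
  -- φ(m) nearby; near an infeasible point all points are infeasible and the condition is vacuous.
  -- In a finite subcover, the m of least value would itself have to lie above another m of the
  -- list.
  minimum-on-polygon : ∀ {S} → HasSubcovers S → ∀ ψs φ {p₀} → S p₀ → InPolygon ψs p₀ →
    ∃[ m ] S m × InPolygon ψs m × (∀ p → S p → InPolygon ψs p → φ at m ≤ φ at p)
  minimum-on-polygon {S} subcovers ψs φ {p₀} p₀∈S p₀∈ψs
    with em {∃[ m ] S m × InPolygon ψs m × (∀ p → S p → InPolygon ψs p → φ at m ≤ φ at p)}
  ... | yes min = min
  ... | no none = ⊥-elim (no-smallest (proj₁ cover) (proj₂ cover))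
    where
    Feasible = ∃[ m ] S m × InPolygon ψs m

    value : Feasible → Carrier
    value (m , _) = φ at m

    Above : Feasible → Point → Set
    Above m q = InPolygon ψs q → value m < φ at q

    above-near : ∀ p → S p → ∃[ m ] ∃[ r ] 0# < r × (∀ q → Near r p q → Above m q)
    above-near p p∈S with em {InPolygon ψs p}
    ... | yes p∈ψs with em {∃[ m ] S m × InPolygon ψs m × φ at m < φ at p}
    ...   | no  least = ⊥-elim (none (p , p∈S , p∈ψs , λ q q∈S q∈ψs φq<φp →
              least (q , q∈S , q∈ψs , φq<φp)))
    ...   | yes (m , m∈S , m∈ψs , φm<φp)
            with r , 0<r , close ← at-continuous φ p (<⇒pos φm<φp) =
      (m , m∈S , m∈ψs) , r , 0<r , λ q p~q _ → pos⇒< (pos-resp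
        (solve 3 (λ x y z → x :- y :+ (y :- z) := x :- z) refl (φ at q) (φ at p) (φ at m))
        (close q p~q))
    above-near p p∈S | no p∉ψs = outside (¬All⇒Any¬ (λ _ → em) ψs p∉ψs)
      where
      outside : Any (λ ψ → ¬ (0# ≤ ψ at p)) ψs →
        ∃[ m ] ∃[ r ] 0# < r × (∀ q → Near r p q → Above m q)
      outside below with ψ , ψ∈ , ψp≱0 ← find below
        with em {ψ at p < 0#}
      ... | no  ψp≮0 = ⊥-elim (ψp≱0 ψp≮0)
      ... | yes ψp<0 with r , 0<r , close ← at-continuous (negate ψ) p (<0⇒pos ψp<0) =
        (p₀ , p₀∈S , p₀∈ψs) , r , 0<r , λ q p~q q∈ψs → ⊥-elim
          (pos+nonneg≉0 (close q p~q) (All.lookup q∈ψs ψ∈)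
            (trans (+-congʳ (+-congʳ (+-cong (at-negate ψ q) (-‿cong (at-negate ψ p)))))
              (solve 2 (λ x y → :- x :- (:- y) :+ :- y :+ x := zro) refl (ψ at q) (ψ at p))))

    cover : ∃[ ms ] (∀ p → S p → Any (λ m → Above m p) ms)
    cover = subcovers Above above-near

    smallest : ∀ m ms → ∃[ k ] All (λ l → value k ≤ value l) (m ∷ ms)
    smallest m [] = m , ≤-refl ∷ []
    smallest m (m′ ∷ ms) with k , k≤ ← smallest m′ ms with ≤-total (value m) (value k)
    ... | inj₁ m≤k = m , ≤-refl ∷ All.map (≤-trans m≤k) k≤
    ... | inj₂ k≤m = k , k≤m ∷ k≤

    no-smallest : ∀ ms → (∀ p → S p → Any (λ m → Above m p) ms) → ⊥
    no-smallest [] covers with () ← covers p₀ p₀∈S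
    no-smallest (m ∷ ms) covers
      with (k , k∈S , k∈ψs) , k≤ ← smallest m ms
      with l , l∈ , above ← find (covers k k∈S) = All.lookup k≤ l∈ (above k∈ψs)

  apart : ∀ {p q} → ¬ (p ≋ q) → ∃[ d ] 0# < d × ¬ Near d p q
  apart {px , py} {qx , qy} p≉q with <-connex px qx | <-connex py qy
  ... | inj₁ px<qx        | _ = qx - px , <⇒pos px<qx , λ (near _ x> _ _) → <-irrefl x>
  ... | inj₂ (inj₂ qx<px) | _ = px - qx , <⇒pos qx<px , λ (near x< _ _ _) → <-irrefl x<
  ... | _ | inj₁ py<qy        = qy - py , <⇒pos py<qy , λ (near _ _ _ y>) → <-irrefl y>
  ... | _ | inj₂ (inj₂ qy<py) = py - qy , <⇒pos qy<py , λ (near _ _ y< _) → <-irrefl y<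
  ... | inj₂ (inj₁ px≈qx) | inj₂ (inj₁ py≈qy) = ⊥-elim (p≉q (px≈qx , py≈qy))

  distant-point : ∀ {S} → HasSubcovers S → ∀ p → (∀ q → S q → ¬ (p ≋ q)) →
    Eventually (λ s → ∀ q → S q → ¬ Near s p q)
  distant-point S-cpt p p∉S = eventually-on-compact (λ s q → ¬ Near s p q) S-cpt
    λ q q∈S →
      let d , 0<d , p≁q = apart (p∉S q q∈S)
          h , 0<h , h+h≈d = half 0<d
      in h , 0<h , λ u q~u s 0<s s≤h p~u →
           p≁q (near-half h+h≈d s≤h ≤-refl p~u (near-sym q~u))

  distant-sets : ∀ {S T} → HasSubcovers S → HasSubcovers T →
    (∀ p q → S p → T q → ¬ (p ≋ q)) →
    Eventually (λ s → ∀ p → S p → ∀ q → T q → ¬ Near s p q)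
  distant-sets {S} {T} S-cpt T-cpt disjoint =
    eventually-on-compact (λ s p → ∀ q → T q → ¬ Near s p q) S-cpt
    λ p p∈S →
      let d , 0<d , far = distant-point T-cpt p (λ q → disjoint p q p∈S)
          h , 0<h , h+h≈d = half 0<d
      in h , 0<h , λ u p~u s 0<s s≤h q q∈T u~q →
           far d 0<d ≤-refl q q∈T (near-half h+h≈d ≤-refl s≤h p~u u~q)

  -- This is φ > -1/(2s), written without division. The 2 is there because `spread` adds two such
  -- bounds to bound a difference by 1/s. The radius is 1/(2k) with k larger than the absolute value
  -- of the minimum of φ.
  eventually-bounded-below : ∀ {S} → HasSubcovers S → ∀ φ →
    Eventually (λ s → ∀ p → S p → 0# < 1# + (s + s) * φ at p)
  eventually-bounded-below {S} S-cpt φ with em {∃[ p ] S p}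
  ... | no  empty = 1# , 0<1 , λ _ _ _ p p∈S → ⊥-elim (empty (p , p∈S))
  ... | yes (p₀ , p₀∈S) =
    let m , _ , _ , least = minimum-on-polygon S-cpt [] φ p₀∈S []
        k , 0<k , _ , 0<k+m = bounding (φ at m)
        r , 0<r , 2kr≈1 = pos-reciprocal (+-pos 0<k 0<k)
    in r , 0<r , λ s 0<s s≤r p p∈S → pos-resp
      (trans (solve 5 (λ s x m k r →
          (s :+ s) :* (k :+ m) :+ ((s :+ s) :* (x :- m) :+ (k :+ k) :* (r :- s)) :=
          (k :+ k) :* r :+ (s :+ s) :* x) refl s (φ at p) (φ at m) k r)
        (+-congʳ 2kr≈1))
      (+-pos-nonneg (*-pos (+-pos 0<s 0<s) 0<k+m)
        (+-nonneg (*-nonneg (<⇒≤ (+-pos 0<s 0<s)) (≤⇒nonneg (least p p∈S [])))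
                  (*-nonneg (<⇒≤ (+-pos 0<k 0<k)) (≤⇒nonneg s≤r))))

  -- Adding φ ≥ 0 to the constraints makes the feasible set closed, so φ attains its minimum there.
  -- This minimum is positive because φ has no zero.
  eventually-below-positive : ∀ {S} → HasSubcovers S → ∀ ψs φ →
    (∀ p → S p → InPolygon ψs p → ¬ (φ at p ≈ 0#)) →
    Eventually (λ s → ∀ p → S p → InPolygon ψs p → 0# < φ at p → s ≤ φ at p)
  eventually-below-positive {S} S-cpt ψs φ φ≉0 with em {∃[ p ] S p × InPolygon (φ ∷ ψs) p}
  ... | no  empty = 1# , 0<1 , λ _ _ _ p p∈S p∈ψs 0<φp →
    ⊥-elim (empty (p , p∈S , <⇒≤ 0<φp ∷ p∈ψs))
  ... | yes (p₀ , p₀∈S , p₀∈)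
    with m , m∈S , 0≤φm ∷ m∈ψs , least ← minimum-on-polygon S-cpt (φ ∷ ψs) φ p₀∈S p₀∈
    with nonneg-split 0≤φm
  ...   | inj₂ φm≈0 = ⊥-elim (φ≉0 m m∈S m∈ψs φm≈0)
  ...   | inj₁ 0<φm = φ at m , 0<φm , λ s _ s≤φm p p∈S p∈ψs 0<φp →
    ≤-trans s≤φm (least p p∈S (<⇒≤ 0<φp ∷ p∈ψs))

-- Arrangements of regions, frames and pairs

module PlaneVisibility (𝔽 : OrderedField) (em : ExcludedMiddle 0ℓ) where
  open OrderedField 𝔽
  open OrderedFieldProperties 𝔽
  open PlaneGeometry 𝔽
  open PlaneCompactness 𝔽 em

  record Arrangement (n : ℕ) : Set₁ where
    field
      region      : Fin n → Point → Set
      extensional : ∀ C {p q} → p ≋ q → region C p → region C q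
      convex      : ∀ C {p q r} → region C p → region C q → segment p q r → region C r
      subcovers   : ∀ C → HasSubcovers (region C)
      disjoint    : ∀ {C D} → C ≢ D → ∀ {p} → region C p → ¬ region D p

  module Sightlines {n} (arrangement : Arrangement n) where
    open Arrangement arrangement

    Sees : Fin n → Fin n → Set
    Sees C D = ∃[ p ] ∃[ q ] region C p × region D q ×
      (∀ E → E ≢ C → E ≢ D → ∀ {r} → segment p q r → ¬ region E r)

    -- Within the strip, height 0 is attained on the segment a b only; this keeps the heights
    -- of the other regions in the strip bounded away from 0.
    record Frame (A B : Fin n) : Set where
      field
        a b        : Point
        a∈A        : region A a
        b∈B        : region B b
        strip      : List Affine
        height     : Affine
        a-strip    : InPolygon strip a
        b-strip    : InPolygon strip b
        height-a   : height at a ≈ 0#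
        height-b   : height at b ≈ 0#
        base       : ∀ p → InPolygon strip p → height at p ≈ 0# → segment a b p
        base-clear : ∀ C → C ≢ A → C ≢ B → ∀ {p} → segment a b p → ¬ region C p

      base-avoided : ∀ {C p} → C ≢ A → C ≢ B → region C p → InPolygon strip p →
        ¬ (height at p ≈ 0#)
      base-avoided {C} {p} C≢A C≢B p∈C p-strip h≈0 =
        base-clear C C≢A C≢B (base p p-strip h≈0) p∈C

    mirror : ∀ {A B} → Frame A B → Frame B A
    mirror fr = record
      { a = b ; b = a ; a∈A = b∈B ; b∈B = a∈A
      ; strip = strip ; height = height ; a-strip = b-strip ; b-strip = a-strip
      ; height-a = height-b ; height-b = height-a
      ; base = λ p p-strip h≈0 → segment-sym (base p p-strip h≈0)
      ; base-clear = λ C C≢B C≢A p∈ → base-clear C C≢A C≢B (segment-sym p∈)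
      }
      where open Frame fr

    flip : ∀ {A B} → Frame A B → Frame A B
    flip fr = record
      { a = a ; b = b ; a∈A = a∈A ; b∈B = b∈B
      ; strip = strip ; height = negate height ; a-strip = a-strip ; b-strip = b-strip
      ; height-a = trans (at-negate height a) (trans (-‿cong height-a) -0≈0)
      ; height-b = trans (at-negate height b) (trans (-‿cong height-b) -0≈0)
      ; base = λ p p-strip h≈0 → base p p-strip
          (trans (solve 1 (λ x → x := :- :- x) refl (height at p))
                 (trans (-‿cong (trans (sym (at-negate height p)) h≈0)) -0≈0))
      ; base-clear = base-clear
      }
      where
      open Frame fr
      -0≈0 : - 0# ≈ 0#
      -0≈0 = solve 0 (:- zro := zro) refl

    record State {A B} (fr : Frame A B) (E : Fin n) (e : Point) (F : Fin n) (f : Point) : Set where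
      open Frame fr
      field
        e∈E      : region E e
        f∈F      : region F f
        e-strip  : InPolygon strip e
        f-strip  : InPolygon strip f
        above    : 0# < height at e
        below    : height at f < 0#
        E≢A      : E ≢ A
        E≢B      : E ≢ B
        F≢A      : F ≢ A
        F≢B      : F ≢ B
        avoids-A : ∀ {r} → segment e f r → ¬ region A r
        avoids-B : ∀ {r} → segment e f r → ¬ region B r

    mirror-state : ∀ {A B} {fr : Frame A B} {E e F f} → State fr E e F f → State (mirror fr) E e F f
    mirror-state st = record
      { e∈E = e∈E ; f∈F = f∈F ; e-strip = e-strip ; f-strip = f-strip ; above = above ; below = below
      ; E≢A = E≢B ; E≢B = E≢A ; F≢A = F≢B ; F≢B = F≢A ; avoids-A = avoids-B ; avoids-B = avoids-A }
      where open State st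

    unmirror-state : ∀ {A B} {fr : Frame A B} {E e F f} → State (mirror fr) E e F f → State fr E e F f
    unmirror-state st = record
      { e∈E = e∈E ; f∈F = f∈F ; e-strip = e-strip ; f-strip = f-strip ; above = above ; below = below
      ; E≢A = E≢B ; E≢B = E≢A ; F≢A = F≢B ; F≢B = F≢A ; avoids-A = avoids-B ; avoids-B = avoids-A }
      where open State st

    flip-state : ∀ {A B} {fr : Frame A B} {E e F f} → State fr E e F f → State (flip fr) F f E e
    flip-state {fr = fr} {e = e} {f = f} st = record
      { e∈E = f∈F ; f∈F = e∈E ; e-strip = f-strip ; f-strip = e-strip
      ; above = pos-resp (sym (at-negate height f)) (<0⇒pos below)
      ; below = pos⇒< (pos-resp
          (trans (solve 1 (λ x → x := zro :- :- x) refl (height at e))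
                 (+-congˡ (-‿cong (sym (at-negate height e))))) above)
      ; E≢A = F≢A ; E≢B = F≢B ; F≢A = E≢A ; F≢B = E≢B
      ; avoids-A = λ r∈ → avoids-A (segment-sym r∈) ; avoids-B = λ r∈ → avoids-B (segment-sym r∈) }
      where
      open Frame fr
      open State st

    unflip-state : ∀ {A B} {fr : Frame A B} {E e F f} → State (flip fr) F f E e → State fr E e F f
    unflip-state {fr = fr} {e = e} {f = f} st = record
      { e∈E = f∈F ; f∈F = e∈E ; e-strip = f-strip ; f-strip = e-strip
      ; above = pos-resp (trans (-‿cong (at-negate height e))
          (solve 1 (λ x → :- :- x := x) refl (height at e))) (<0⇒pos below)
      ; below = pos⇒< (pos-resp (trans (at-negate height f) (sym (+-identityˡ _))) above)
      ; E≢A = F≢A ; E≢B = F≢B ; F≢A = E≢A ; F≢B = E≢B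
      ; avoids-A = λ r∈ → avoids-A (segment-sym r∈) ; avoids-B = λ r∈ → avoids-B (segment-sym r∈) }
      where
      open Frame fr
      open State st

    -- `spread₁` and `spread₂` say that coordinate differences are below 1/s. `separated` allows C =
    -- D, so that a blocking point is excluded by deriving an equality of regions.
    record Tolerance {A B} (fr : Frame A B) (s : Carrier) : Set where
      open Frame fr
      field
        0<s       : 0# < s
        separated : ∀ C D p q → region C p → region D q → Near s p q → C ≡ D
        spread₁   : ∀ C D p q → region C p → region D q → 0# < 1# - s * (proj₁ p - proj₁ q)
        spread₂   : ∀ C D p q → region C p → region D q → 0# < 1# - s * (proj₂ p - proj₂ q)
        high      : ∀ C → C ≢ A → C ≢ B → ∀ p → region C p → InPolygon strip p →
                    0# < height at p → s ≤ height at p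
        low       : ∀ C → C ≢ A → C ≢ B → ∀ p → region C p → InPolygon strip p →
                    height at p < 0# → s ≤ - (height at p)

    mirror-tolerance : ∀ {A B} {fr : Frame A B} {s} → Tolerance fr s → Tolerance (mirror fr) s
    mirror-tolerance tol = record
      { 0<s = 0<s ; separated = separated ; spread₁ = spread₁ ; spread₂ = spread₂
      ; high = λ C C≢B C≢A → high C C≢A C≢B ; low = λ C C≢B C≢A → low C C≢A C≢B }
      where open Tolerance tol

    flip-tolerance : ∀ {A B} {fr : Frame A B} {s} → Tolerance fr s → Tolerance (flip fr) s
    flip-tolerance {fr = fr} tol = record
      { 0<s = 0<s ; separated = separated ; spread₁ = spread₁ ; spread₂ = spread₂
      ; high = λ C C≢A C≢B p p∈C p-strip 0<-h → ≤-trans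
          (low C C≢A C≢B p p∈C p-strip (pos⇒< (pos-resp
            (trans (at-negate height p) (sym (+-identityˡ _))) 0<-h)))
          (≈⇒≤ (sym (at-negate height p)))
      ; low = λ C C≢A C≢B p p∈C p-strip -h<0 →
          let h≈ = trans (-‿cong (at-negate height p))
                         (solve 1 (λ x → :- :- x := x) refl (height at p))
          in ≤-trans (high C C≢A C≢B p p∈C p-strip (pos-resp h≈ (<0⇒pos -h<0)))
                     (≈⇒≤ (sym h≈)) }
      where
      open Frame fr
      open Tolerance tol

    record Unimprovable {A B} (fr : Frame A B) (s : Carrier)
      (E : Fin n) (e : Point) (F : Fin n) (f : Point) : Set where
      open Frame fr
      field
        upper : ∀ C o → State fr C o F f → height at e - height at o < s * s * s
        lower : ∀ C o → State fr E e C o → height at o - height at f < s * s * s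

    mirror-unimprovable : ∀ {A B} {fr : Frame A B} {s E e F f} →
      Unimprovable fr s E e F f → Unimprovable (mirror fr) s E e F f
    mirror-unimprovable u = record
      { upper = λ C o st → upper C o (unmirror-state st)
      ; lower = λ C o st → lower C o (unmirror-state st) }
      where open Unimprovable u

    flip-unimprovable : ∀ {A B} {fr : Frame A B} {s E e F f} →
      Unimprovable fr s E e F f → Unimprovable (flip fr) s F f E e
    flip-unimprovable {fr = fr} u = record
      { upper = λ C o st → <-resp-≈ (negated _ _) refl (lower C o (unflip-state st))
      ; lower = λ C o st → <-resp-≈ (negated _ _) refl (upper C o (unflip-state st)) }
      where
      open Frame fr
      open Unimprovable u
      negated : ∀ p q → height at p - height at q ≈ negate height at q - negate height at p
      negated p q = trans (solve 2 (λ x y → x :- y := :- y :- :- x) refl (height at p) (height at q))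
        (+-cong (sym (at-negate height q)) (-‿cong (sym (at-negate height p))))

    -- A step of relative length below s² is shorter than s, hence stays in its region.
    same-region : ∀ {A B} {fr : Frame A B} {s} → Tolerance fr s →
      ∀ {C D G H p q r₁ r₂} → region C p → region D q → region G r₁ → region H r₂ →
      ∀ {β γ} → 0# ≤ β → 0# ≤ γ → β + γ < s * s →
      (∀ φ → φ at q ≈ φ at p + (β * (φ at r₁ - φ at p) + γ * (φ at r₂ - φ at p))) → C ≡ D
    same-region {s = s} tol {C} {D} {G} {H} {p} {q} {r₁} {r₂} p∈C q∈D r₁∈G r₂∈H {β} {γ}
      0≤β 0≤γ β+γ<s² at-q =
      separated C D p q p∈C q∈D (near
        (backward (step proj₁ coord₁ at-coord₁)
          (spread₁ C G p r₁ p∈C r₁∈G) (spread₁ C H p r₂ p∈C r₂∈H))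
        (forward (step proj₁ coord₁ at-coord₁)
          (spread₁ G C r₁ p r₁∈G p∈C) (spread₁ H C r₂ p r₂∈H p∈C))
        (backward (step proj₂ coord₂ at-coord₂)
          (spread₂ C G p r₁ p∈C r₁∈G) (spread₂ C H p r₂ p∈C r₂∈H))
        (forward (step proj₂ coord₂ at-coord₂)
          (spread₂ G C r₁ p r₁∈G p∈C) (spread₂ H C r₂ p r₂∈H p∈C)))
      where
      open Tolerance tol

      step : ∀ (π : Point → Carrier) φ → (∀ u → φ at u ≈ π u) →
        π q ≈ π p + (β * (π r₁ - π p) + γ * (π r₂ - π p))
      step π φ same = trans (sym (same q)) (trans (at-q φ) (+-cong (same p) (+-cong
        (*-congˡ (+-cong (same r₁) (-‿cong (same p))))
        (*-congˡ (+-cong (same r₂) (-‿cong (same p)))))))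

      forward : ∀ {x y u v} → y ≈ x + (β * (u - x) + γ * (v - x)) →
        0# < 1# - s * (u - x) → 0# < 1# - s * (v - x) → y - x < s
      forward {x} {y} {u} {v} y≈ 0<₁ 0<₂ = pos⇒< (*-cancel-pos 0<s (pos-resp
        (trans (solve 6 (λ s x u v β γ →
            s :* s :- (β :+ γ) :+ (β :* (one :- s :* (u :- x)) :+ γ :* (one :- s :* (v :- x))) :=
            s :* (s :- (x :+ (β :* (u :- x) :+ γ :* (v :- x)) :- x))) refl s x u v β γ)
          (*-congˡ (+-congˡ (-‿cong (+-congʳ (sym y≈))))))
        (+-pos-nonneg (<⇒pos β+γ<s²)
          (+-nonneg (*-nonneg 0≤β (<⇒≤ 0<₁)) (*-nonneg 0≤γ (<⇒≤ 0<₂))))))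

      backward : ∀ {x y u v} → y ≈ x + (β * (u - x) + γ * (v - x)) →
        0# < 1# - s * (x - u) → 0# < 1# - s * (x - v) → x - y < s
      backward {x} {y} {u} {v} y≈ 0<₁ 0<₂ = pos⇒< (*-cancel-pos 0<s (pos-resp
        (trans (solve 6 (λ s x u v β γ →
            s :* s :- (β :+ γ) :+ (β :* (one :- s :* (x :- u)) :+ γ :* (one :- s :* (x :- v))) :=
            s :* (s :- (x :- (x :+ (β :* (u :- x) :+ γ :* (v :- x)))))) refl s x u v β γ)
          (*-congˡ (+-congˡ (-‿cong (+-congˡ (-‿cong (sym y≈)))))))
        (+-pos-nonneg (<⇒pos β+γ<s²)
          (+-nonneg (*-nonneg 0≤β (<⇒≤ 0<₁)) (*-nonneg 0≤γ (<⇒≤ 0<₂))))))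

    -- A drop below s³ from height ≥ s means a relative step below s².
    small-step : ∀ {s h x k} → 0# < s → s ≤ h → 0# ≤ x → x * h ≤ k → k < s * s * s → x < s * s
    small-step {s} {h} {x} {k} 0<s s≤h 0≤x xh≤k k<s³ = pos⇒< (*-cancel-pos 0<s (pos-resp
      (solve 4 (λ s h x k → s :* s :* s :- k :+ (k :- x :* h :+ x :* (h :- s)) := s :* (s :* s :- x))
        refl s h x k)
      (+-pos-nonneg (<⇒pos k<s³) (+-nonneg (≤⇒nonneg xh≤k) (*-nonneg 0≤x (≤⇒nonneg s≤h))))))

    strip-segment : ∀ ψs {p q r} → InPolygon ψs p → InPolygon ψs q → segment p q r → InPolygon ψs r
    strip-segment []       []         []         r∈ = []
    strip-segment (ψ ∷ ψs) (0≤p ∷ p∈) (0≤q ∷ q∈) r∈ =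
      at-segment-nonneg ψ 0≤p 0≤q r∈ ∷ strip-segment ψs p∈ q∈ r∈

    -- Sightlines of an unimprovable pair: from E to F

    foot : ∀ {A B} {fr : Frame A B} {E e F f} → State fr E e F f →
      ∃[ z ] segment e f z × segment (Frame.a fr) (Frame.b fr) z
    foot {fr = fr} {e = e} {f = f} st =
      let z , z∈ef , hz≈0 = zero-between height e f (<⇒≤ above) (<⇒≤ below)
      in z , z∈ef , base z (strip-segment strip e-strip f-strip z∈ef) hz≈0
      where
      open Frame fr
      open State st

    sees-across : ∀ {A B} {fr : Frame A B} {s} → Tolerance fr s → ∀ {E e F f} →
      State fr E e F f → Unimprovable fr s E e F f → Sees E F
    sees-across {fr = fr} {s} tol {E} {e} {F} {f} st unimprovable =
      e , f , e∈E , f∈F , blocked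
      where
      open Frame fr
      open Tolerance tol
      open State st
      open Unimprovable unimprovable

      blocked : ∀ C → C ≢ E → C ≢ F → ∀ {o} → segment e f o → ¬ region C o
      blocked C C≢E C≢F {o} o∈ef@(between t 0≤t 0≤1-t at-o) o∈C =
        by-height (<-connex 0# (height at o))
        where
        C≢A : C ≢ _
        C≢A ≡.refl = avoids-A o∈ef o∈C
        C≢B : C ≢ _
        C≢B ≡.refl = avoids-B o∈ef o∈C
        o-strip = strip-segment strip e-strip f-strip o∈ef
        by-height : _ → ⊥
        by-height (inj₂ (inj₁ 0≈h)) = base-avoided C≢A C≢B o∈C o-strip (sym 0≈h)
        -- Replacing e by o lowers the height by t (h(e) - h(f)) ≥ t h(e), so `small-step` bounds t.
        -- `same-region` takes two directions of displacement; here both point to f, the second with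
        -- weight 0.
        by-height (inj₁ 0<h) = C≢E (≡.sym (same-region tol e∈E o∈C f∈F f∈F 0≤t ≤-refl
          (<-resp-≈ (sym (+-identityʳ t)) refl
            (small-step 0<s (high E E≢A E≢B e e∈E e-strip above) 0≤t
            (nonneg⇒≤ (nonneg-resp
              (trans (solve 3 (λ t x y → t :* :- y := x :- ((one :- t) :* x :+ t :* y) :- t :* x)
                 refl t (height at e) (height at f))
                (+-congʳ (+-congˡ (-‿cong (sym (at-o height))))))
              (*-nonneg 0≤t (<⇒≤ (<0⇒pos below)))))
            (upper C o record
              { e∈E = o∈C ; f∈F = f∈F ; e-strip = o-strip ; f-strip = f-strip ; above = 0<h
              ; below = below ; E≢A = C≢A ; E≢B = C≢B ; F≢A = F≢A ; F≢B = F≢B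
              ; avoids-A = λ r∈ → avoids-A (subsegment o∈ef r∈)
              ; avoids-B = λ r∈ → avoids-B (subsegment o∈ef r∈) })))
          (λ φ → trans (at-o φ) (solve 3 (λ t x y → (one :- t) :* x :+ t :* y :=
            x :+ (t :* (y :- x) :+ zro :* (y :- x))) refl t (φ at e) (φ at f)))))
        -- Symmetrically, o is reached from f by the fraction 1 - t of the way to e.
        by-height (inj₂ (inj₂ h<0)) = C≢F (≡.sym (same-region tol f∈F o∈C e∈E e∈E 0≤1-t ≤-refl
          (<-resp-≈ (sym (+-identityʳ (1# - t))) refl
            (small-step 0<s (low F F≢A F≢B f f∈F f-strip below) 0≤1-t
            (nonneg⇒≤ (nonneg-resp
              (trans (solve 3 (λ t x y →
                 (one :- t) :* x := (one :- t) :* x :+ t :* y :- y :- (one :- t) :* :- y)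
                 refl t (height at e) (height at f))
                (+-congʳ (+-congʳ (sym (at-o height)))))
              (*-nonneg 0≤1-t (<⇒≤ above))))
            (lower C o record
              { e∈E = e∈E ; f∈F = o∈C ; e-strip = e-strip ; f-strip = o-strip ; above = above
              ; below = h<0 ; E≢A = E≢A ; E≢B = E≢B ; F≢A = C≢A ; F≢B = C≢B
              ; avoids-A = λ r∈ →
                  avoids-A (segment-sym (subsegment (segment-sym o∈ef) (segment-sym r∈)))
              ; avoids-B = λ r∈ →
                  avoids-B (segment-sym (subsegment (segment-sym o∈ef) (segment-sym r∈))) })))
          (λ φ → trans (at-o φ) (solve 3 (λ t x y → (one :- t) :* x :+ t :* y :=
            y :+ ((one :- t) :* (x :- y) :+ zro :* (x :- y))) refl t (φ at e) (φ at f)))))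

    -- Sightlines of an unimprovable pair: from E to A

    module NearestPoint {A B} {fr : Frame A B} {s} (tol : Tolerance fr s) {E e F f}
      (st : State fr E e F f) (unimprovable : Unimprovable fr s E e F f)
      (coordinates : Barycentric e (Frame.a fr) f) where
      open Frame fr
      open Tolerance tol
      open State st
      open Unimprovable unimprovable
      open Barycentric coordinates

      α-e : α at e ≈ 1#
      α-e = trans (solve 1 (λ x → x := x :+ zro :+ zro) refl (α at e))
        (trans (+-cong (+-congˡ (sym β-e)) (sym γ-e)) (sum≈1 e))

      γ-f : γ at f ≈ 1#
      γ-f = trans (solve 1 (λ x → x := zro :+ zro :+ x) refl (γ at f))
        (trans (+-congʳ (+-cong (sym α-f) (sym β-f))) (sum≈1 f))

      0≤0 : ∀ {x} → x ≈ 0# → 0# ≤ x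
      0≤0 x≈0 = ≈⇒≤ (sym x≈0)

      0≤1 : ∀ {x} → x ≈ 1# → 0# ≤ x
      0≤1 x≈1 = nonneg-resp (sym x≈1) (<⇒≤ 0<1)

      -- The cone with apex a through e and f, which continues beyond ef. It replaces the triangle
      -- because `β-positive` shows that A has no point of the cone on or beyond ef, while b has to
      -- be located beyond ef in the same cone.
      Wedge : Point → Set
      Wedge = InPolygon (α ∷ γ ∷ [])

      e-wedge : Wedge e
      e-wedge = 0≤1 α-e ∷ 0≤0 γ-e ∷ []

      f-wedge : Wedge f
      f-wedge = 0≤0 α-f ∷ 0≤1 γ-f ∷ []

      -- Within the wedge, β = 0 describes exactly the segment ef, with γ as the weight. By
      -- convexity a region with points of the wedge on both sides meets ef, which A and B do not.
      crossing : ∀ C {p q} → region C p → region C q → Wedge p → Wedge q →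
        0# ≤ β at p → β at q ≤ 0# → ∃[ r ] segment e f r × region C r
      crossing C {p} {q} p∈C q∈C p-wedge q-wedge 0≤βp βq≤0
        with r , r∈pq , βr≈0 ← zero-between β p q 0≤βp βq≤0
        with 0≤α ∷ 0≤γ ∷ [] ← strip-segment (α ∷ γ ∷ []) p-wedge q-wedge r∈pq =
        r , between (γ at r) 0≤γ (nonneg-resp α≈1-γ 0≤α) (λ φ → trans (expand φ r)
          (trans (+-congʳ (+-cong (*-congʳ α≈1-γ) (trans (*-congʳ βr≈0) (zeroˡ _))))
            (+-congʳ (+-identityʳ _)))) ,
        convex C p∈C q∈C r∈pq
        where
        α≈1-γ : α at r ≈ 1# - γ at r
        α≈1-γ = trans (solve 2 (λ x y → x := x :+ zro :+ y :- y) refl (α at r) (γ at r))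
          (+-congʳ (trans (+-congʳ (+-congˡ (sym βr≈0))) (sum≈1 r)))

      β-positive : ∀ {l} → region A l → Wedge l → 0# < β at l
      β-positive l∈A l-wedge = decidable-stable em λ βl≯0 →
        let r , r∈ef , r∈A = crossing A a∈A l∈A (0≤0 α-a ∷ 0≤0 γ-a ∷ []) l-wedge (0≤1 β-a) βl≯0
        in avoids-A r∈ef r∈A

      -- The segment ab meets ef in a point z = (1 - t) a + t b. As β is 1 at a and 0 at z, t is
      -- positive and β(b) cannot be. As α and γ vanish at a, their signs at b are those at z.
      b-beyond : Wedge b × β at b ≤ 0#
      b-beyond with z , z∈ef , between t 0≤t 0≤1-t at-z ← foot st
        with 0≤αz ∷ 0≤γz ∷ [] ← strip-segment (α ∷ γ ∷ []) e-wedge f-wedge z∈ef =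
        (cancel α α-a 0≤αz ∷ cancel γ γ-a 0≤γz ∷ []) ,
        λ 0<βb → pos+nonneg≉0 (*-pos 0<t 0<βb) 0≤1-t
          (trans (solve 2 (λ x t → t :* x :+ (one :- t) := (one :- t) :* one :+ t :* x) refl (β at b) t)
            (trans (+-congʳ (*-congˡ (sym β-a))) (trans (sym (at-z β)) (βz≈0 z∈ef))))
        where
        βz≈0 : ∀ {z} → segment e f z → β at z ≈ 0#
        βz≈0 (between u _ _ at-z) = trans (at-z β) (trans (+-cong (*-congˡ β-e) (*-congˡ β-f))
          (solve 1 (λ u → (one :- u) :* zro :+ u :* zro := zro) refl u))
        0<t : 0# < t
        0<t with nonneg-split 0≤t
        ... | inj₁ 0<t = 0<t
        ... | inj₂ t≈0 = ⊥-elim (<-irrefl (pos-resp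
          (trans (solve 1 (λ x → one := (one :- zro) :* one :+ zro :* x) refl (β at b))
            (trans (+-cong (*-cong (+-congˡ (-‿cong (sym t≈0))) (sym β-a)) (*-congʳ (sym t≈0)))
              (trans (sym (at-z β)) (βz≈0 z∈ef)))) 0<1))
        cancel : ∀ φ → φ at a ≈ 0# → 0# ≤ φ at z → 0# ≤ φ at b
        cancel φ φa≈0 0≤φz = *-cancel-nonneg 0<t (nonneg-resp
          (trans (at-z φ) (trans (+-congʳ (trans (*-congˡ φa≈0) (zeroʳ _))) (+-identityˡ _))) 0≤φz)

      β-nonneg⇒∉B : ∀ {p} → Wedge p → 0# ≤ β at p → ¬ region B p
      β-nonneg⇒∉B p-wedge 0≤βp p∈B =
        let r , r∈ef , r∈B = crossing B p∈B b∈B p-wedge (proj₁ b-beyond) 0≤βp (proj₂ b-beyond)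
        in avoids-B r∈ef r∈B

      hull-strip : ∀ ψs → InPolygon ψs e → InPolygon ψs a → InPolygon ψs f →
        ∀ p → 0# ≤ α at p → 0# ≤ β at p → 0# ≤ γ at p → InPolygon ψs p
      hull-strip [] _ _ _ p _ _ _ = []
      hull-strip (ψ ∷ ψs) (0≤e ∷ e∈) (0≤a ∷ a∈) (0≤f ∷ f∈) p 0≤α 0≤β 0≤γ =
        nonneg-resp (sym (expand ψ p))
          (+-nonneg (+-nonneg (*-nonneg 0≤α 0≤e) (*-nonneg 0≤β 0≤a)) (*-nonneg 0≤γ 0≤f)) ∷
        hull-strip ψs e∈ a∈ f∈ p 0≤α 0≤β 0≤γ

      module Blocker {l} (l∈A : region A l) (l-wedge : Wedge l)
        (l-nearest : ∀ p → region A p → Wedge p → β at l ≤ β at p)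
        {C o} (C≢E : C ≢ E) (C≢A : C ≢ A) (o∈el : segment e l o) (o∈C : region C o) where
        0<βl : 0# < β at l
        0<βl = β-positive l∈A l-wedge

        open segment o∈el using ()
          renaming (weight to t; 0≤weight to 0≤t; 0≤coweight to 0≤1-t; at-segment to at-o)

        o-wedge : Wedge o
        o-wedge = strip-segment (α ∷ γ ∷ []) e-wedge l-wedge o∈el

        0≤αo : 0# ≤ α at o
        0≤αo = All.head o-wedge

        0≤γo : 0# ≤ γ at o
        0≤γo = All.head (All.tail o-wedge)

        vanishing-at-e : ∀ φ → φ at e ≈ 0# → φ at o ≈ t * φ at l
        vanishing-at-e φ φe≈0 = trans (at-o φ)
          (trans (+-congʳ (trans (*-congˡ φe≈0) (zeroʳ _))) (+-identityˡ _))

        0≤βo : 0# ≤ β at o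
        0≤βo = nonneg-resp (sym (vanishing-at-e β β-e)) (*-nonneg 0≤t (<⇒≤ 0<βl))

        C≢B : C ≢ B
        C≢B ≡.refl = β-nonneg⇒∉B o-wedge 0≤βo o∈C

        o-strip : InPolygon strip o
        o-strip = hull-strip strip e-strip a-strip f-strip o 0≤αo 0≤βo 0≤γo

        α-complement : ∀ p → α at p ≈ 1# - (β at p + γ at p)
        α-complement p = trans
          (solve 3 (λ x y z → x := x :+ y :+ z :- (y :+ z)) refl (α at p) (β at p) (γ at p))
          (+-congʳ (sum≈1 p))

        γ-complement : ∀ p → γ at p ≈ 1# - (α at p + β at p)
        γ-complement p = trans
          (solve 3 (λ x y z → z := x :+ y :+ z :- (x :+ y)) refl (α at p) (β at p) (γ at p))
          (+-congʳ (sum≈1 p))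

        -- The weight t = 1 would make o equal to l, a point of A, although C differs from A.
        t≱1 : ¬ (0# ≤ t - 1#)
        t≱1 0≤t-1 with nonneg-split 0≤1-t
        ... | inj₁ 0<1-t = pos+nonneg≉0 0<1-t 0≤t-1
          (solve 1 (λ t → one :- t :+ (t :- one) := zro) refl t)
        ... | inj₂ 1-t≈0 = disjoint C≢A o∈C (extensional A
          (affine-separated (λ φ → sym (trans (at-o φ) (trans
            (solve 3 (λ t x y → (one :- t) :* x :+ t :* y := (one :- t) :* (x :- y) :+ y)
              refl t (φ at e) (φ at l))
            (trans (+-congʳ (trans (*-congʳ 1-t≈0) (zeroˡ _))) (+-identityˡ _))))))
          l∈A)

        -- Along the segment β is at most β at o < β at l, while l minimises β on A.
        avoids-A-from : ∀ {g} → Wedge g → β at g ≈ 0# → ∀ {q} → segment o g q → ¬ region A q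
        avoids-A-from {g} g-wedge βg≈0 {q} q∈@(between u 0≤u 0≤1-u at-q) q∈A =
          t≱1 (*-cancel-nonneg 0<βl (nonneg-resp
            (trans (+-congʳ (+-congʳ (trans (at-q β)
                (+-cong (*-congˡ (vanishing-at-e β β-e)) (*-congˡ βg≈0)))))
              (solve 3 (λ u t x →
                (one :- u) :* (t :* x) :+ u :* zro :- x :+ u :* (t :* x) := x :* (t :- one))
                refl u t (β at l)))
            (+-nonneg (≤⇒nonneg (l-nearest q q∈A (strip-segment _ o-wedge g-wedge q∈)))
                      (*-nonneg 0≤u (*-nonneg 0≤t (<⇒≤ 0<βl))))))

        avoids-B-from : ∀ {g} → Wedge g → β at g ≈ 0# → ∀ {q} → segment o g q → ¬ region B q
        avoids-B-from g-wedge βg≈0 q∈ =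
          β-nonneg⇒∉B (strip-segment _ o-wedge g-wedge q∈)
            (at-segment-nonneg β 0≤βo (0≤0 βg≈0) q∈)

        -- From e, the point o is reached by β(o) times the vector to a plus γ(o) times the vector
        -- to f. Since h(a) = 0 and h(f) < 0, the drop is at least (β(o) + γ(o)) h(e), which bounds
        -- the sum of the two weights.
        not-above : ¬ (0# < height at o)
        not-above 0<h = C≢E (≡.sym (same-region tol e∈E o∈C a∈A f∈F 0≤βo 0≤γo
          (small-step 0<s (high E E≢A E≢B e e∈E e-strip above) (+-nonneg 0≤βo 0≤γo)
            (nonneg⇒≤ (nonneg-resp
              (trans (solve 4 (λ y z h k →
                  z :* :- k := h :- ((one :- (y :+ z)) :* h :+ y :* zro :+ z :* k) :- (y :+ z) :* h)
                  refl (β at o) (γ at o) (height at e) (height at f))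
                (+-congʳ (+-congˡ (-‿cong (trans
                  (+-congʳ (+-cong (*-congʳ (sym (α-complement o))) (*-congˡ (sym height-a))))
                  (sym (expand height o)))))))
              (*-nonneg 0≤γo (<⇒≤ (<0⇒pos below)))))
            (upper C o record
              { e∈E = o∈C ; f∈F = f∈F ; e-strip = o-strip ; f-strip = f-strip ; above = 0<h
              ; below = below ; E≢A = C≢A ; E≢B = C≢B ; F≢A = F≢A ; F≢B = F≢B
              ; avoids-A = avoids-A-from f-wedge β-f
              ; avoids-B = avoids-B-from f-wedge β-f }))
          (λ φ → trans (expand φ o) (trans (+-congʳ (+-congʳ (*-congʳ (α-complement o))))
            (solve 5 (λ y z u v w → (one :- (y :+ z)) :* u :+ y :* v :+ z :* w :=
              u :+ (y :* (v :- u) :+ z :* (w :- u)))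
              refl (β at o) (γ at o) (φ at e) (φ at a) (φ at f))))))

        -- On el, γ(o) = t γ(l) and γ(l) = 1 - (α(l) + β(l)) ≤ 1, so γ(o) ≤ t. Hence h(o) - h(f) =
        -- α(o) h(e) + (1 - γ(o)) (-h(f)) ≥ (1 - t) (-h(f)). This bounds 1 - t, the fraction of the
        -- way from l to e at which o lies.
        not-below : ¬ (height at o < 0#)
        not-below h<0 = C≢A (≡.sym (same-region tol l∈A o∈C e∈E e∈E 0≤1-t ≤-refl
          (<-resp-≈ (sym (+-identityʳ (1# - t))) refl
            (small-step 0<s (low F F≢A F≢B f f∈F f-strip below) 0≤1-t
              (nonneg⇒≤ (nonneg-resp
                (trans (solve 6 (λ t x z w h k →
                    x :* h :+ t :* z :* :- k :=
                    x :* h :+ w :* zro :+ t :* (one :- z) :* k :- k :- (one :- t) :* :- k)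
                    refl t (α at o) (α at l + β at l) (β at o) (height at e) (height at f))
                  (+-congʳ (+-congʳ (trans
                    (+-cong (+-congˡ (*-congˡ (sym height-a)))
                      (*-congʳ (trans (*-congˡ (sym (γ-complement l)))
                        (sym (vanishing-at-e γ γ-e)))))
                    (sym (expand height o))))))
                (+-nonneg (*-nonneg 0≤αo (<⇒≤ above))
                  (*-nonneg (*-nonneg 0≤t (+-nonneg (All.head l-wedge) (<⇒≤ 0<βl)))
                    (<⇒≤ (<0⇒pos below))))))
              (lower C o record
                { e∈E = e∈E ; f∈F = o∈C ; e-strip = e-strip ; f-strip = o-strip ; above = above
                ; below = h<0 ; E≢A = E≢A ; E≢B = E≢B ; F≢A = C≢A ; F≢B = C≢B
                ; avoids-A = λ r∈ → avoids-A-from e-wedge β-e (segment-sym r∈)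
                ; avoids-B = λ r∈ → avoids-B-from e-wedge β-e (segment-sym r∈) })))
          (λ φ → trans (at-o φ) (solve 3 (λ t x y → (one :- t) :* x :+ t :* y :=
            y :+ ((one :- t) :* (x :- y) :+ zro :* (x :- y))) refl t (φ at e) (φ at l)))))

        absurd : ⊥
        absurd with <-connex 0# (height at o)
        ... | inj₁ 0<h        = not-above 0<h
        ... | inj₂ (inj₂ h<0) = not-below h<0
        ... | inj₂ (inj₁ 0≈h) = base-avoided C≢A C≢B o∈C o-strip (sym 0≈h)

      sees-first : Sees E A
      sees-first =
        let l , l∈A , l-wedge , l-nearest =
              -- Up to a constant factor β is the distance from the line ef, on the side of a.
              minimum-on-polygon (subcovers A) (α ∷ γ ∷ []) β a∈A (0≤0 α-a ∷ 0≤0 γ-a ∷ [])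
        in e , l , e∈E , l∈A , λ C C≢E C≢A o∈el o∈C →
             Blocker.absurd l∈A l-wedge l-nearest C≢E C≢A o∈el o∈C

    sees-first : ∀ {A B} {fr : Frame A B} {s} → Tolerance fr s → ∀ {E e F f} →
      State fr E e F f → Unimprovable fr s E e F f → Sees E A
    sees-first {fr = fr} tol {e = e} {f = f} st unimprovable =
      -- The triangle is not degenerate: if e, a, f were collinear, then a, whose height 0 lies
      -- between those of f and e, would be on ef, which misses A.
      NearestPoint.sees-first tol st unimprovable (barycentric e a f λ D≈0 →
        avoids-A
        (collinear-between height (<-trans below above) (≤-trans (<⇒≤ below) (≈⇒≤ (sym height-a)))
          (≤-trans (≈⇒≤ height-a) (<⇒≤ above)) D≈0) a∈A)
      where
      open Frame fr
      open State st

    record AdjacentCommonNeighbours (A B : Fin n) : Set where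
      field
        E F      : Fin n
        E≢F      : E ≢ F
        E≢A      : E ≢ A
        E≢B      : E ≢ B
        F≢A      : F ≢ A
        F≢B      : F ≢ B
        E-sees-F : Sees E F
        E-sees-A : Sees E A
        E-sees-B : Sees E B
        F-sees-A : Sees F A
        F-sees-B : Sees F B

    unimprovable⇒neighbours : ∀ {A B} {fr : Frame A B} {s} → Tolerance fr s → ∀ {E e F f} →
      State fr E e F f → Unimprovable fr s E e F f → AdjacentCommonNeighbours A B
    unimprovable⇒neighbours {A} {B} {fr} tol {E} {e} {F} {f} st u = record
      { E = E ; F = F
      -- If E = F, convexity would put the intersection of ef and ab into E, but ab misses E.
      ; E≢F = λ { ≡.refl → let z , z∈ef , z∈ab = foot st
                            in Frame.base-clear fr E E≢A E≢B z∈ab (convex E e∈E f∈F z∈ef) }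
      ; E≢A = E≢A ; E≢B = E≢B ; F≢A = F≢A ; F≢B = F≢B
      ; E-sees-F = sees-across tol st u
      ; E-sees-A = sees-first tol st u
      ; E-sees-B = sees-first (mirror-tolerance tol) (mirror-state st) (mirror-unimprovable u)
      ; F-sees-A = sees-first (flip-tolerance tol) (flip-state st) (flip-unimprovable u)
      ; F-sees-B = sees-first (mirror-tolerance (flip-tolerance tol))
          (mirror-state (flip-state st)) (mirror-unimprovable (flip-unimprovable u))
      }
      where open State st

    -- The number k bounds the improvements that can still follow. It cannot reach 0, because h(e) >
    -- 0 > h(f) in every pair.
    descend : ∀ {A B} {fr : Frame A B} {s} → Tolerance fr s → ∀ k {E e F f} → State fr E e F f →
      Frame.height fr at e - Frame.height fr at f ≤ RawMonoid._×_ +-rawMonoid k (s * s * s) →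
      AdjacentCommonNeighbours A B
    descend {fr = fr} tol ℕ.zero {e = e} {f = f} st gap≤0 =
      ⊥-elim (gap≤0 (+-pos above (<0⇒pos below)))
      where open State st
    descend {fr = fr} {s} tol (ℕ.suc k) {E} {e} {F} {f} st gap≤
      with em {∃[ C ] ∃[ o ] State fr C o F f × s * s * s ≤ Frame.height fr at e - Frame.height fr at o}
         | em {∃[ C ] ∃[ o ] State fr E e C o × s * s * s ≤ Frame.height fr at o - Frame.height fr at f}
    ... | yes (C , o , st′ , drop) | _ = descend tol k st′ (nonneg⇒≤ (nonneg-resp
      (solve 5 (λ x y z d m → d :+ m :- (x :- y) :+ (x :- z :- d) := m :- (z :- y)) refl
        (Frame.height fr at e) (Frame.height fr at f) (Frame.height fr at o) (s * s * s)
        (RawMonoid._×_ +-rawMonoid k (s * s * s)))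
      (+-nonneg (≤⇒nonneg gap≤) (≤⇒nonneg drop))))
    ... | no _ | yes (C , o , st′ , drop) = descend tol k st′ (nonneg⇒≤ (nonneg-resp
      (solve 5 (λ x y z d m → d :+ m :- (x :- y) :+ (z :- y :- d) := m :- (x :- z)) refl
        (Frame.height fr at e) (Frame.height fr at f) (Frame.height fr at o) (s * s * s)
        (RawMonoid._×_ +-rawMonoid k (s * s * s)))
      (+-nonneg (≤⇒nonneg gap≤) (≤⇒nonneg drop))))
    ... | no no-upper | no no-lower = unimprovable⇒neighbours tol st record
      { upper = λ C o st′ → decidable-stable em λ drop≮ → no-upper (C , o , st′ , drop≮)
      ; lower = λ C o st′ → decidable-stable em λ drop≮ → no-lower (C , o , st′ , drop≮)
      }

    -- Choice of the tolerance

    Bounded : Fin n → Affine → Carrier → Set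
    Bounded C φ s = ∀ p → region C p → 0# < 1# + (s + s) * φ at p

    spread : ∀ (π : Point → Carrier) φ → (∀ u → φ at u ≈ π u) → ∀ {s C D p q} →
      region C p → region D q → Bounded C (negate φ) s → Bounded D φ s → 0# < 1# - s * (π p - π q)
    spread π φ same {s} {p = p} {q} p∈C q∈D C-bounded D-bounded = *-cancel-pos (+-pos 0<1 0<1) (pos-resp
      (trans (+-cong (+-congˡ (*-congˡ (trans (at-negate φ p) (-‿cong (same p)))))
                     (+-congˡ (*-congˡ (same q))))
        (solve 3 (λ s x y → one :+ (s :+ s) :* :- x :+ (one :+ (s :+ s) :* y) :=
          (one :+ one) :* (one :- s :* (x :- y))) refl s (π p) (π q)))
      (+-pos (C-bounded p p∈C) (D-bounded q q∈D)))

    Separated : Fin n → Fin n → Carrier → Set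
    Separated C D s = ∀ p → region C p → ∀ q → region D q → Near s p q → C ≡ D

    eventually-separated : ∀ C D → Eventually (Separated C D)
    eventually-separated C D with C Fin.≟ D
    ... | yes C≡D = 1# , 0<1 , λ _ _ _ _ _ _ _ _ → C≡D
    ... | no  C≢D =
      let r , 0<r , far = distant-sets (subcovers C) (subcovers D)
            (λ p q p∈C q∈D p≋q → disjoint C≢D (extensional C p≋q p∈C) q∈D)
      in r , 0<r , λ s 0<s s≤r p p∈C q q∈D p~q → ⊥-elim (far s 0<s s≤r p p∈C q q∈D p~q)

    eventually-bounded : ∀ C → Eventually (λ s →
      (Bounded C coord₁ s × Bounded C (negate coord₁) s) ×
      (Bounded C coord₂ s × Bounded C (negate coord₂) s))
    eventually-bounded C =
      eventually-× (λ s → Bounded C coord₁ s × Bounded C (negate coord₁) s)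
                   (λ s → Bounded C coord₂ s × Bounded C (negate coord₂) s)
        (eventually-× (Bounded C coord₁) (Bounded C (negate coord₁))
          (eventually-bounded-below (subcovers C) coord₁)
          (eventually-bounded-below (subcovers C) (negate coord₁)))
        (eventually-× (Bounded C coord₂) (Bounded C (negate coord₂))
          (eventually-bounded-below (subcovers C) coord₂)
          (eventually-bounded-below (subcovers C) (negate coord₂)))

    module _ {A B} (fr : Frame A B) where
      open Frame fr

      High : Affine → Fin n → Carrier → Set
      High φ C s = C ≢ A → C ≢ B → ∀ p → region C p → InPolygon strip p → 0# < φ at p → s ≤ φ at p

      -- Stated for a general φ with no zeros other than those of `height`, so that `negate height`
      -- yields the bound below the line ab.
      eventually-high : ∀ φ → (∀ p → φ at p ≈ 0# → height at p ≈ 0#) → ∀ C → Eventually (High φ C)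
      eventually-high φ zeros C with C Fin.≟ A | C Fin.≟ B
      ... | yes C≡A | _ = 1# , 0<1 , λ _ _ _ C≢A → ⊥-elim (C≢A C≡A)
      ... | no _ | yes C≡B = 1# , 0<1 , λ _ _ _ _ C≢B → ⊥-elim (C≢B C≡B)
      ... | no C≢A | no C≢B =
        let r , 0<r , above = eventually-below-positive (subcovers C) strip φ
              (λ p p∈C p-strip φp≈0 → base-avoided C≢A C≢B p∈C p-strip (zeros p φp≈0))
        in r , 0<r , λ s 0<s s≤r _ _ → above s 0<s s≤r

      negate-zeros : ∀ p → negate height at p ≈ 0# → height at p ≈ 0#
      negate-zeros p -h≈0 = trans (solve 1 (λ x → x := :- :- x) refl (height at p))
        (trans (-‿cong (trans (sym (at-negate height p)) -h≈0)) (solve 0 (:- zro := zro) refl))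

      All-separated All-bounded All-high All-low : Carrier → Set
      All-separated s = ∀ C D → Separated C D s
      All-bounded s = ∀ C →
        (Bounded C coord₁ s × Bounded C (negate coord₁) s) ×
        (Bounded C coord₂ s × Bounded C (negate coord₂) s)
      All-high s = ∀ C → High height C s
      All-low s = ∀ C → High (negate height) C s

      tolerance : ∃[ s ] Tolerance fr s
      tolerance =
        let r , 0<r , holds = eventually-×
              (λ s → All-separated s × All-bounded s) (λ s → All-high s × All-low s)
              (eventually-× All-separated All-bounded
                (eventually-Fin (λ C s → ∀ D → Separated C D s)
                  (λ C → eventually-Fin (Separated C) (eventually-separated C)))
                (eventually-Fin _ eventually-bounded))
              (eventually-× All-high All-low
                (eventually-Fin (High height) (eventually-high height (λ _ h≈0 → h≈0)))
                (eventually-Fin (High (negate height)) (eventually-high (negate height) negate-zeros)))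
            (sep , bnd) , (hgh , lw) = holds r 0<r ≤-refl
        in r , record
          { 0<s = 0<r
          ; separated = λ C D p q p∈C q∈D → sep C D p p∈C q q∈D
          ; spread₁ = λ C D p q p∈C q∈D → spread proj₁ coord₁ at-coord₁ p∈C q∈D
              (proj₂ (proj₁ (bnd C))) (proj₁ (proj₁ (bnd D)))
          ; spread₂ = λ C D p q p∈C q∈D → spread proj₂ coord₂ at-coord₂ p∈C q∈D
              (proj₂ (proj₂ (bnd C))) (proj₁ (proj₂ (bnd D)))
          ; high = hgh
          ; low = λ C C≢A C≢B p p∈C p-strip h<0 → ≤-trans
              (lw C C≢A C≢B p p∈C p-strip (pos-resp (sym (at-negate height p)) (<0⇒pos h<0)))
              (≈⇒≤ (at-negate height p))
          }

      state⇒neighbours : ∀ {E e F f} → State fr E e F f → AdjacentCommonNeighbours A B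
      state⇒neighbours {e = e} {f = f} st =
        let s , tol = tolerance
            0<s = Tolerance.0<s tol
            k , gap≤ = archimedean (height at e - height at f) (*-pos (*-pos 0<s 0<s) 0<s)
        in descend tol k st gap≤

    -- The first frame and pair, from the two crossing sightlines

    shift : Carrier → Affine → Affine
    shift k (affine u v w) = affine u v (w - k)

    at-shift : ∀ k φ p → shift k φ at p ≈ φ at p - k
    at-shift k (affine u v w) (x , y) = solve 6
      (λ k u v w x y → u :* x :+ v :* y :+ (w :- k) := u :* x :+ v :* y :+ w :- k)
      refl k u v w x y

    -- Both sides are the determinant of w - v and b - a. It links the two lines: if v and w have
    -- different heights, then a and b have different levels.
    lines-cross : ∀ a b v w → line v w at b - line v w at a ≈ line a b at v - line a b at w
    lines-cross (ax , ay) (bx , by) (vx , vy) (wx , wy) = solve 8 (λ ax ay bx by vx vy wx wy →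
      (vy :- wy) :* bx :+ (wx :- vx) :* by :+ (vx :* wy :- vy :* wx) :-
      ((vy :- wy) :* ax :+ (wx :- vx) :* ay :+ (vx :* wy :- vy :* wx)) :=
      (ay :- by) :* vx :+ (bx :- ax) :* vy :+ (ax :* by :- ay :* bx) :-
      ((ay :- by) :* wx :+ (bx :- ax) :* wy :+ (ax :* by :- ay :* bx)))
      refl ax ay bx by vx vy wx wy

    module Crossing {A B V W : Fin n} {a b v w x : Point}
      (A≢B : A ≢ B) (V≢A : V ≢ A) (V≢B : V ≢ B) (W≢A : W ≢ A) (W≢B : W ≢ B)
      (a∈A : region A a) (b∈B : region B b) (v∈V : region V v) (w∈W : region W w)
      (ab-clear : ∀ C → C ≢ A → C ≢ B → ∀ {r} → segment a b r → ¬ region C r)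
      (vw-avoids-A : ∀ {r} → segment v w r → ¬ region A r)
      (vw-avoids-B : ∀ {r} → segment v w r → ¬ region B r)
      (x∈ab : segment a b x) (x∈vw : segment v w x) where
      open segment x∈ab using ()
        renaming (weight to s; 0≤weight to 0≤s; 0≤coweight to 0≤1-s; at-segment to at-x)
      open segment x∈vw public using ()
        renaming (weight to t; 0≤weight to 0≤t; 0≤coweight to 0≤1-t; at-segment to at-x′)

      height : Affine
      height = line a b

      level : Affine
      level = line v w

      v∉ab : ¬ segment a b v
      v∉ab v∈ab = ab-clear V V≢A V≢B v∈ab v∈V

      w∉ab : ¬ segment a b w
      w∉ab w∈ab = ab-clear W W≢A W≢B w∈ab w∈W

      height-x : (1# - t) * height at v + t * height at w ≈ 0#
      height-x = trans (sym (at-x′ height)) (trans (at-x height)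
        (trans (+-cong (*-congˡ (line-start a b)) (*-congˡ (line-end a b)))
          (solve 1 (λ s → (one :- s) :* zro :+ s :* zro := zro) refl s)))

      -- The weight t = 0 would place v at x, hence on ab, which V avoids. In the same way `0<1-t`
      -- keeps w off ab.
      0<t : 0# < t
      0<t with nonneg-split 0≤t
      ... | inj₁ 0<t = 0<t
      ... | inj₂ t≈0 = ⊥-elim (v∉ab (segment-resp (affine-separated λ φ → trans (at-x′ φ)
        (trans (+-cong (*-congʳ (+-congˡ (-‿cong t≈0))) (*-congʳ t≈0))
          (solve 2 (λ y z → (one :- zro) :* y :+ zro :* z := y) refl (φ at v) (φ at w)))) x∈ab))

      0<1-t : 0# < 1# - t
      0<1-t with nonneg-split 0≤1-t
      ... | inj₁ 0<1-t = 0<1-t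
      ... | inj₂ 1-t≈0 = ⊥-elim (w∉ab (segment-resp (affine-separated λ φ → trans (at-x′ φ)
        (trans (solve 3 (λ t y z → (one :- t) :* y :+ t :* z := (one :- t) :* (y :- z) :+ z) refl t _ _)
          (trans (+-congʳ (trans (*-congʳ 1-t≈0) (zeroˡ _))) (+-identityˡ _)))) x∈ab))

      module Oriented (0<hv : 0# < height at v) where
        hw<0 : height at w < 0#
        hw<0 = pos⇒< (pos-resp (sym (+-identityˡ _)) (*-cancel-pos 0<t (pos-resp
          (trans (solve 3 (λ t y z → (one :- t) :* y := (one :- t) :* y :+ t :* z :+ t :* :- z)
                   refl t (height at v) (height at w))
            (trans (+-congʳ height-x) (+-identityˡ _)))
          (*-pos 0<1-t 0<hv))))

        gap : 0# < level at b - level at a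
        gap = pos-resp (sym (lines-cross a b v w)) (+-pos 0<hv (<0⇒pos hw<0))

        -- The common point x has level 0, so 0 lies between the levels of a and b. This puts v and
        -- w, also of level 0, into the strip.
        level-x : (1# - s) * level at a + s * level at b ≈ 0#
        level-x = trans (sym (at-x level)) (trans (at-x′ level)
          (trans (+-cong (*-congˡ (line-start v w)) (*-congˡ (line-end v w)))
            (solve 1 (λ t → (one :- t) :* zro :+ t :* zro := zro) refl t)))

        0≤-level-a : 0# ≤ 0# - level at a
        0≤-level-a = nonneg-resp
          (trans (solve 3 (λ s y z → s :* (z :- y) := (one :- s) :* y :+ s :* z :- y)
                   refl s (level at a) (level at b)) (+-congʳ level-x))
          (*-nonneg 0≤s (<⇒≤ gap))

        0≤level-b : 0# ≤ - (0# - level at b)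
        0≤level-b = nonneg-resp
          (trans (solve 3 (λ s y z → (one :- s) :* (z :- y) := :- ((one :- s) :* y :+ s :* z :- z))
                   refl s (level at a) (level at b)) (-‿cong (+-congʳ level-x)))
          (*-nonneg 0≤1-s (<⇒≤ gap))

        strip : List Affine
        strip = shift (level at a) level ∷ negate (shift (level at b) level) ∷ []

        in-strip : ∀ p → 0# ≤ level at p - level at a → 0# ≤ - (level at p - level at b) →
          InPolygon strip p
        in-strip p left right =
          nonneg-resp (sym (at-shift (level at a) level p)) left ∷
          nonneg-resp (sym (trans (at-negate (shift (level at b) level) p)
            (-‿cong (at-shift (level at b) level p)))) right ∷ []

        -- By `gap` the level increases strictly from a to b along their line, so a point of that
        -- line with a level in between lies on the segment.
        base : ∀ p → InPolygon strip p → height at p ≈ 0# → segment a b p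
        base p (left ∷ right ∷ []) hp≈0 = segment-sym (collinear-between level (pos⇒< gap)
          (nonneg⇒≤ (nonneg-resp (at-shift (level at a) level p) left))
          (nonneg⇒≤ (nonneg-resp (trans (at-negate (shift (level at b) level) p)
            (trans (-‿cong (at-shift (level at b) level p))
              (solve 2 (λ y z → :- (y :- z) := z :- y) refl (level at p) (level at b)))) right))
          (trans (sym (line-apex b p a)) hp≈0))

        frame : Frame A B
        frame = record
          { a = a ; b = b ; a∈A = a∈A ; b∈B = b∈B ; strip = strip ; height = height
          ; a-strip = in-strip a
              (≈⇒≤ (sym (-‿inverseʳ _)))
              (nonneg-resp (solve 2 (λ y z → z :- y := :- (y :- z)) refl _ _) (<⇒≤ gap))
          ; b-strip = in-strip b (<⇒≤ gap)
              (≈⇒≤ (solve 1 (λ y → zro := :- (y :- y)) refl _))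
          ; height-a = line-start a b
          ; height-b = line-end a b
          ; base = base
          ; base-clear = ab-clear
          }

        on-level : ∀ p → level at p ≈ 0# → InPolygon strip p
        on-level p lp≈0 = in-strip p
          (nonneg-resp (+-congʳ (sym lp≈0)) 0≤-level-a)
          (nonneg-resp (-‿cong (+-congʳ (sym lp≈0))) 0≤level-b)

        neighbours : AdjacentCommonNeighbours A B
        neighbours = state⇒neighbours frame {V} {v} {W} {w} record
          { e∈E = v∈V ; f∈F = w∈W
          ; e-strip = on-level v (line-start v w) ; f-strip = on-level w (line-end v w)
          ; above = 0<hv ; below = hw<0
          ; E≢A = V≢A ; E≢B = V≢B ; F≢A = W≢A ; F≢B = W≢B
          ; avoids-A = vw-avoids-A ; avoids-B = vw-avoids-B
          }

      -- With v on the line ab, w is on it too, and neither lies on the segment ab. On opposite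
      -- sides of it, vw would contain a, though it misses A. On the same side, vw would be disjoint
      -- from ab, which the common point x excludes.
      module Collinear (hv≈0 : height at v ≈ 0#) where
        hw≈0 : height at w ≈ 0#
        hw≈0 = *-cancel-zero 0<t (trans
          (trans (sym (+-identityˡ _)) (+-congʳ (sym (trans (*-congˡ hv≈0) (zeroʳ _))))) height-x)

        -- The inner product of b - a with p - a: the position along the line ab, scaled by the
        -- length of b - a.
        direction : Affine
        direction = affine (proj₁ b - proj₁ a) (proj₂ b - proj₂ a)
          (- ((proj₁ b - proj₁ a) * proj₁ a + (proj₂ b - proj₂ a) * proj₂ a))

        direction-a : direction at a ≈ 0#
        direction-a = solve 4 (λ ax ay bx by →
          (bx :- ax) :* ax :+ (by :- ay) :* ay :+ :- ((bx :- ax) :* ax :+ (by :- ay) :* ay) := zro)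
          refl (proj₁ a) (proj₂ a) (proj₁ b) (proj₂ b)

        squares : direction at b ≈
          (proj₁ b - proj₁ a) * (proj₁ b - proj₁ a) + (proj₂ b - proj₂ a) * (proj₂ b - proj₂ a)
        squares = solve 4 (λ ax ay bx by →
          (bx :- ax) :* bx :+ (by :- ay) :* by :+ :- ((bx :- ax) :* ax :+ (by :- ay) :* ay) :=
          (bx :- ax) :* (bx :- ax) :+ (by :- ay) :* (by :- ay))
          refl (proj₁ a) (proj₂ a) (proj₁ b) (proj₂ b)

        0<direction-b : 0# < direction at b
        0<direction-b = pos-resp (sym squares) (sum-of-squares (proj₁ b - proj₁ a) (proj₂ b - proj₂ a)
          λ (dx≈0 , dy≈0) → disjoint A≢B a∈A
            (extensional B (≈-from-difference dx≈0 , ≈-from-difference dy≈0) b∈B))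
          where
          square-pos : ∀ y → ¬ (y ≈ 0#) → 0# < y * y
          square-pos y y≉0 with <-connex 0# y
          ... | inj₁ 0<y        = *-pos 0<y 0<y
          ... | inj₂ (inj₁ 0≈y) = ⊥-elim (y≉0 (sym 0≈y))
          ... | inj₂ (inj₂ y<0) = pos-resp (solve 1 (λ y → :- y :* :- y := y :* y) refl y)
            (*-pos (<0⇒pos y<0) (<0⇒pos y<0))
          sum-of-squares : ∀ y z → ¬ (y ≈ 0# × z ≈ 0#) → 0# < y * y + z * z
          sum-of-squares y z not-both with em {y ≈ 0#}
          ... | no  y≉0 = +-pos-nonneg (square-pos y y≉0) (square-nonneg z)
          ... | yes y≈0 = pos-resp (+-comm _ _)
            (+-pos-nonneg (square-pos z (λ z≈0 → not-both (y≈0 , z≈0))) (square-nonneg y))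

        on-line : ∀ p → height at p ≈ 0# → 0# ≤ direction at p → direction at p ≤ direction at b →
          segment a b p
        on-line p hp≈0 0≤dp dp≤db = segment-sym (collinear-between direction
          (<-resp-≈ (sym direction-a) refl 0<direction-b) (≤-trans (≈⇒≤ direction-a) 0≤dp) dp≤db
          (trans (sym (line-apex b p a)) hp≈0))

        outside : ∀ p → height at p ≈ 0# → ¬ segment a b p →
          direction at p < 0# ⊎ direction at b < direction at p
        outside p hp≈0 p∉ab with em {direction at p < 0#} | em {direction at b < direction at p}
        ... | yes dp<0 | _       = inj₁ dp<0
        ... | no _     | yes b<p = inj₂ b<p
        ... | no p≮0   | no b≮p  = ⊥-elim (p∉ab (on-line p hp≈0 p≮0 b≮p))

        direction-x : (1# - t) * direction at v + t * direction at w ≈ s * direction at b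
        direction-x = trans (sym (at-x′ direction)) (trans (at-x direction)
          (trans (+-congʳ (trans (*-congˡ direction-a) (zeroʳ _))) (+-identityˡ _)))

        -- Position and height relative to ab are orthogonal coordinates with origin a, both
        -- stretched by the length of b - a. So their determinant is the area stretched by the
        -- square of that length, which is `direction at b`.
        cross-by-lines : ∀ p q → direction at b * cross q a p ≈
          height at q * direction at p - height at p * direction at q
        cross-by-lines p q = trans (*-congʳ squares) (solve 8 (λ ax ay bx by px py qx qy →
          ((bx :- ax) :* (bx :- ax) :+ (by :- ay) :* (by :- ay)) :*
            ((ax :- qx) :* (py :- qy) :- (ay :- qy) :* (px :- qx)) :=
          ((ay :- by) :* qx :+ (bx :- ax) :* qy :+ (ax :* by :- ay :* bx)) :*
            ((bx :- ax) :* px :+ (by :- ay) :* py :+ :- ((bx :- ax) :* ax :+ (by :- ay) :* ay)) :-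
          ((ay :- by) :* px :+ (bx :- ax) :* py :+ (ax :* by :- ay :* bx)) :*
            ((bx :- ax) :* qx :+ (by :- ay) :* qy :+ :- ((bx :- ax) :* ax :+ (by :- ay) :* ay)))
          refl (proj₁ a) (proj₂ a) (proj₁ b) (proj₂ b) (proj₁ p) (proj₂ p) (proj₁ q) (proj₂ q))

        a-between : ∀ {p q} → height at p ≈ 0# → height at q ≈ 0# → direction at p < 0# →
          direction at b < direction at q → segment q p a
        a-between {p} {q} hp≈0 hq≈0 dp<0 db<dq = collinear-between direction (<-trans dp<0 0<dq)
          (≤-trans (<⇒≤ dp<0) (≈⇒≤ (sym direction-a))) (≤-trans (≈⇒≤ direction-a) (<⇒≤ 0<dq))
          (*-cancel-zero 0<direction-b (trans (cross-by-lines p q)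
            (trans (+-cong (trans (*-congʳ hq≈0) (zeroˡ _)) (-‿cong (trans (*-congʳ hp≈0) (zeroˡ _))))
              (-‿inverseʳ 0#))))
          where
          0<dq = <-trans 0<direction-b db<dq

        absurd : ⊥
        absurd = by-sides (outside v hv≈0 v∉ab) (outside w hw≈0 w∉ab)
          where
          by-sides : direction at v < 0# ⊎ direction at b < direction at v →
            direction at w < 0# ⊎ direction at b < direction at w → ⊥
          by-sides (inj₁ dv<0) (inj₂ db<dw) =
            vw-avoids-A (segment-sym (a-between hv≈0 hw≈0 dv<0 db<dw)) a∈A
          by-sides (inj₂ db<dv) (inj₁ dw<0) = vw-avoids-A (a-between hw≈0 hv≈0 dw<0 db<dv) a∈A
          by-sides (inj₁ dv<0) (inj₁ dw<0) = pos+nonneg≉0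
            (+-pos (*-pos 0<1-t (<0⇒pos dv<0)) (*-pos 0<t (<0⇒pos dw<0)))
            (*-nonneg 0≤s (<⇒≤ 0<direction-b))
            (trans (+-congˡ (sym direction-x)) (solve 3 (λ t y z →
              (one :- t) :* :- y :+ t :* :- z :+ ((one :- t) :* y :+ t :* z) := zro)
              refl t (direction at v) (direction at w)))
          by-sides (inj₂ db<dv) (inj₂ db<dw) = pos+nonneg≉0
            (+-pos (*-pos 0<1-t (<⇒pos db<dv)) (*-pos 0<t (<⇒pos db<dw)))
            (*-nonneg 0≤1-s (<⇒≤ 0<direction-b))
            (trans (solve 5 (λ s t c y z →
              (one :- t) :* (y :- c) :+ t :* (z :- c) :+ (one :- s) :* c :=
              (one :- t) :* y :+ t :* z :- s :* c) refl s t
                (direction at b) (direction at v) (direction at w))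
              (trans (+-congʳ direction-x) (-‿inverseʳ _)))

    crossing⇒neighbours : ∀ {A B V W a b v w x} →
      A ≢ B → V ≢ A → V ≢ B → W ≢ A → W ≢ B →
      region A a → region B b → region V v → region W w →
      (∀ C → C ≢ A → C ≢ B → ∀ {r} → segment a b r → ¬ region C r) →
      (∀ {r} → segment v w r → ¬ region A r) → (∀ {r} → segment v w r → ¬ region B r) →
      segment a b x → segment v w x → AdjacentCommonNeighbours A B
    crossing⇒neighbours {a = a} {b} {v} {w} A≢B V≢A V≢B W≢A W≢B a∈A b∈B v∈V w∈W
      ab-clear avoids-A avoids-B x∈ab x∈vw
      with <-connex 0# (line a b at v)
    ... | inj₁ 0<hv = Crossing.Oriented.neighbours A≢B V≢A V≢B W≢A W≢B a∈A b∈B v∈V w∈W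
      ab-clear avoids-A avoids-B x∈ab x∈vw 0<hv
    ... | inj₂ (inj₁ 0≈hv) = ⊥-elim (Crossing.Collinear.absurd A≢B V≢A V≢B W≢A W≢B a∈A b∈B v∈V w∈W
      ab-clear avoids-A avoids-B x∈ab x∈vw (sym 0≈hv))
    -- With v and w exchanged this is the first case again: x between them and h(v) < 0 force h(w) >
    -- 0.
    ... | inj₂ (inj₂ hv<0) = Crossing.Oriented.neighbours A≢B W≢A W≢B V≢A V≢B a∈A b∈B w∈W v∈V
      ab-clear (λ r∈ → avoids-A (segment-sym r∈)) (λ r∈ → avoids-B (segment-sym r∈))
      x∈ab (segment-sym x∈vw) (*-cancel-pos 0<t (pos-resp
        (trans (solve 3 (λ t y z → (one :- t) :* :- y := t :* z :- ((one :- t) :* y :+ t :* z))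
          refl t (line a b at v) (line a b at w))
          (trans (+-congˡ (-‿cong height-x)) (solve 1 (λ y → y :- zro := y) refl _)))
        (*-pos 0<1-t (<0⇒pos hv<0))))
      where open Crossing A≢B V≢A V≢B W≢A W≢B a∈A b∈B v∈V w∈W ab-clear avoids-A avoids-B x∈ab x∈vw

-- Error estimates for the terms of Cauchy sequences

module Approximation (𝔽 : OrderedField) where
  open OrderedField 𝔽 renaming (refl to ≈-refl)
  open OrderedFieldProperties 𝔽
  open RawMonoid +-rawMonoid using () renaming (_×_ to _·_)

  -- This is |x - y| < ε, split into two inequalities so that its rules reduce to ring identities.
  -- It is used over ℚ.
  record Close (ε x y : Carrier) : Set where
    no-eta-equality
    pattern
    constructor close
    field
      left  : x - y < ε
      right : y - x < ε

  close-sym : ∀ {ε x y} → Close ε x y → Close ε y x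
  close-sym (close l r) = close r l

  close-refl : ∀ {ε} x → 0# < ε → Close ε x x
  close-refl x 0<ε = close x-x<ε x-x<ε
    where x-x<ε = <-resp-≈ (sym (-‿inverseʳ x)) ≈-refl 0<ε

  close-trans : ∀ {ε h x y z} → h + h ≈ ε → Close h x y → Close h y z → Close ε x z
  close-trans {ε} {h} h+h≈ε (close l r) (close l′ r′) = close (add l l′) (add r′ r)
    where
    add : ∀ {x y z} → x - y < h → y - z < h → x - z < ε
    add {x} {y} {z} x-y<h y-z<h = pos⇒< (pos-resp
      (trans (solve 4 (λ x y z h → h :- (x :- y) :+ (h :- (y :- z)) := h :+ h :- (x :- z)) ≈-refl x y z h)
             (+-congʳ h+h≈ε))
      (+-pos (<⇒pos x-y<h) (<⇒pos y-z<h)))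

  close-+ : ∀ {ε h x y u v} → h + h ≈ ε → Close h x u → Close h y v → Close ε (x + y) (u + v)
  close-+ {ε} {h} h+h≈ε (close l r) (close l′ r′) = close (add l l′) (add r r′)
    where
    add : ∀ {x y u v} → x - u < h → y - v < h → x + y - (u + v) < ε
    add {x} {y} {u} {v} x-u<h y-v<h = pos⇒< (pos-resp
      (trans (solve 5 (λ x y u v h →
          h :- (x :- u) :+ (h :- (y :- v)) := h :+ h :- (x :+ y :- (u :+ v))) ≈-refl x y u v h)
             (+-congʳ h+h≈ε))
      (+-pos (<⇒pos x-u<h) (<⇒pos y-v<h)))

  close-neg : ∀ {ε x y} → Close ε x y → Close ε (- x) (- y)
  close-neg {x = x} {y} (close l r) = close
    (<-resp-≈ (solve 2 (λ x y → y :- x := :- x :- :- y) ≈-refl x y) ≈-refl r)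
    (<-resp-≈ (solve 2 (λ x y → x :- y := :- y :- :- x) ≈-refl x y) ≈-refl l)

  -- Each of the two replacements costs k = ε/4, so half of the gap ε survives.
  close-< : ∀ {ε h k x y u v} → h + h ≈ ε → k + k ≈ h → x + ε < y → Close k x u → Close k y v →
    u + h < v
  close-< {ε} {h} {k} {x} {y} {u} {v} h+h≈ε k+k≈h x+ε<y (close _ u-x<k) (close y-v<k _) = pos⇒< (pos-resp
    (trans (+-congʳ (+-congʳ (+-congˡ (-‿cong (+-congˡ (trans (sym h+h≈ε) (+-congˡ (sym k+k≈h))))))))
      (solve 6 (λ x y u v h k → y :- (x :+ (h :+ (k :+ k))) :+ (k :- (u :- x)) :+ (k :- (y :- v)) :=
        v :- (u :+ h)) ≈-refl x y u v h k))
    (+-pos (+-pos (<⇒pos x+ε<y) (<⇒pos u-x<k)) (<⇒pos y-v<k)))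

  half< : ∀ {ε h} → 0# < h → h + h ≈ ε → h < ε
  half< {ε} {h} 0<h h+h≈ε = pos⇒< (pos-resp
    (trans (solve 1 (λ h → h := h :+ h :- h) ≈-refl h) (+-congʳ h+h≈ε)) 0<h)

  close-mono : ∀ {ε δ x y} → ε < δ → Close ε x y → Close δ x y
  close-mono ε<δ (close l r) = close (<-trans l ε<δ) (<-trans r ε<δ)

  close-connex : ∀ {ε δ x y} → δ < ε → ¬ (y + δ < x) → ¬ (x + δ < y) → Close ε x y
  close-connex {ε} {δ} δ<ε x≤y+δ y≤x+δ = close (side x≤y+δ) (side y≤x+δ)
    where
    side : ∀ {x y} → x ≤ y + δ → x - y < ε
    side {x} {y} x≤y+δ = pos⇒< (pos-resp
      (solve 4 (λ x y δ ε → ε :- δ :+ (y :+ δ :- x) := ε :- (x :- y)) ≈-refl x y δ ε)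
      (+-pos-nonneg (<⇒pos δ<ε) (≤⇒nonneg x≤y+δ)))

  <-weaken : ∀ {ε x y} → 0# < ε → x + ε < y → x < y
  <-weaken {ε} {x} {y} 0<ε x+ε<y = <-trans (pos⇒< (pos-resp
    (solve 2 (λ x ε → ε := x :+ ε :- x) ≈-refl x ε) 0<ε)) x+ε<y

  -- The summands `0#` match the unfolding of `0ℝ < x`, which compares the terms of `0ℝ` plus ε with
  -- those of x.
  *-separation : ∀ {ε δ x y} → 0# < ε → 0# < δ → 0# + ε < x → 0# + δ < y → 0# + ε * δ < x * y
  *-separation {ε} {δ} {x} {y} 0<ε 0<δ ε<x δ<y = pos⇒< (pos-resp
    (solve 4 (λ ε δ x y → (x :- (zro :+ ε)) :* (y :- (zro :+ δ)) :+ δ :* (x :- (zro :+ ε)) :+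
      ε :* (y :- (zro :+ δ)) := x :* y :- (zro :+ ε :* δ)) ≈-refl ε δ x y)
    (+-pos (+-pos (*-pos (<⇒pos ε<x) (<⇒pos δ<y)) (*-pos 0<δ (<⇒pos ε<x))) (*-pos 0<ε (<⇒pos δ<y))))

  -- Reciprocals of reals > ε are < j = ε⁻¹, and x ↦ x⁻¹ is j²-Lipschitz there.
  reciprocal-close : ∀ {ε j δ x y x⁻¹ y⁻¹} → 0# < δ → ε * j ≈ 1# → 0# < ε → 0# < j →
    ε < x → ε < y → 0# < x⁻¹ → 0# < y⁻¹ → x * x⁻¹ ≈ 1# → y * y⁻¹ ≈ 1# →
    Close δ x y → Close (j * j * δ) x⁻¹ y⁻¹
  reciprocal-close {ε} {j} {δ} 0<δ εj≈1 0<ε 0<j ε<x ε<y 0<x⁻¹ 0<y⁻¹ xx⁻¹≈1 yy⁻¹≈1 (close l r) =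
    close (side ε<x ε<y 0<x⁻¹ 0<y⁻¹ xx⁻¹≈1 yy⁻¹≈1 r) (side ε<y ε<x 0<y⁻¹ 0<x⁻¹ yy⁻¹≈1 xx⁻¹≈1 l)
    where
    below-j : ∀ {x x⁻¹} → ε < x → 0# < x⁻¹ → x * x⁻¹ ≈ 1# → 0# < j - x⁻¹
    below-j {x} {x⁻¹} ε<x 0<x⁻¹ xx⁻¹≈1 = *-cancel-pos 0<ε (pos-resp
      (trans (solve 3 (λ ε x i → (x :- ε) :* i := x :* i :- ε :* i) ≈-refl ε x x⁻¹)
        (trans (+-congʳ (trans xx⁻¹≈1 (sym εj≈1)))
          (solve 3 (λ ε j i → ε :* j :- ε :* i := ε :* (j :- i)) ≈-refl ε j x⁻¹)))
      (*-pos (<⇒pos ε<x) 0<x⁻¹))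
    side : ∀ {x y x⁻¹ y⁻¹} → ε < x → ε < y → 0# < x⁻¹ → 0# < y⁻¹ → x * x⁻¹ ≈ 1# → y * y⁻¹ ≈ 1# →
      y - x < δ → x⁻¹ - y⁻¹ < j * j * δ
    side {x} {y} {a} {b} ε<x ε<y 0<a 0<b xa≈1 yb≈1 y-x<δ = pos⇒< (pos-resp
      (trans (solve 6 (λ j δ x y a b →
          a :* b :* (δ :- (y :- x)) :+ ((j :- a) :* j :+ a :* (j :- b)) :* δ :=
          j :* j :* δ :- (y :* b :* a :- x :* a :* b)) ≈-refl j δ x y a b)
        (+-congˡ (-‿cong (+-cong (trans (*-congʳ yb≈1) (*-identityˡ a))
          (-‿cong (trans (*-congʳ xa≈1) (*-identityˡ b)))))))
      (+-pos (*-pos (*-pos 0<a 0<b) (<⇒pos y-x<δ))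
        (*-pos (+-pos (*-pos (below-j ε<x 0<a xa≈1) 0<j) (*-pos 0<a (below-j ε<y 0<b yb≈1))) 0<δ)))

  ·-mono-≤ : ∀ k {x y} → x < y → ¬ (k · y < k · x)
  ·-mono-≤ zero            x<y = <-irrefl
  ·-mono-≤ (suc k) {x} {y} x<y = nonneg⇒≤ (nonneg-resp
    (solve 4 (λ x y m l → y :- x :+ (m :- l) := y :+ m :- (x :+ l)) ≈-refl x y (k · y) (k · x))
    (+-nonneg (<⇒≤ (<⇒pos x<y)) (≤⇒nonneg (·-mono-≤ k x<y))))

open import Defs
open ≡ using (refl)

-- The rationals as an ordered field

ℚ-orderedField : OrderedField
ℚ-orderedField = record
  { commutativeRing = ℚ.+-*-commutativeRing
  ; _<_             = ℚ._<_
  ; <-resp-≈        = λ { refl refl x<y → x<y }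
  ; <-irrefl        = ℚ.<-irrefl refl
  ; <-trans         = ℚ.<-trans
  ; <-connex        = connex
  ; +-monoˡ-<       = ℚ.+-monoˡ-<
  ; *-pos           = λ {x} {y} 0<x 0<y → ℚ.positive⁻¹ (x ℚ.* y)
      {{ℚ.pos*pos⇒pos x {{ℚ.positive 0<x}} y {{ℚ.positive 0<y}}}}
  ; pos-inverse     = λ {x} 0<x → let instance _ = ℚ.pos⇒nonZero x {{ℚ.positive 0<x}}
                                  in ℚ.1/ x , ℚ.*-inverseʳ x
  ; 0<1             = ℚ.positive⁻¹ 1ℚ
  ; archimedean     = archimedean
  }
  where
  connex : ∀ x y → x ℚ.< y ⊎ x ≡ y ⊎ y ℚ.< x
  connex x y with ℚ.<-cmp x y
  ... | tri< x<y _ _ = inj₁ x<y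
  ... | tri≈ _ x≡y _ = inj₂ (inj₁ x≡y)
  ... | tri> _ _ y<x = inj₂ (inj₂ y<x)

  open RawMonoid ℚ.+-0-rawMonoid using () renaming (_×_ to _·_)

  -- Unnormalised rationals are used because their sums are not reduced by a gcd and equality is
  -- cross-multiplication.
  numeral : ∀ k → ℚ.toℚᵘ (k · 1ℚ) ℚᵘ.≃ mkℚᵘ (ℤ.+ k) 0
  numeral zero    = ℚᵘ.≃-refl
  numeral (suc k) = ℚᵘ.≃-trans (ℚ.toℚᵘ-homo-+ 1ℚ (k · 1ℚ))
    (ℚᵘ.≃-trans (ℚᵘ.+-congʳ (mkℚᵘ (ℤ.+ 1) 0) (numeral k))
      (ℚᵘ.*≡* (≡.cong (λ i → (ℤ.+ 1 ℤ.+ i) ℤ.* ℤ.+ 1) (ℤ.*-identityʳ (ℤ.+ k)))))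

  i≤∣i∣ : ∀ i → i ℤ.≤ ℤ.+ ℤ.∣ i ∣
  i≤∣i∣ (ℤ.+ k)    = ℤ.≤-refl
  i≤∣i∣ ℤ.-[1+ k ] = ℤ.-≤+

  -- The denominator is at least 1, so dropping it cannot decrease the absolute value.
  numerator-bound : ∀ q → q ℚ.≤ ℤ.∣ ℚ.↥ q ∣ · 1ℚ
  numerator-bound (ℚ.mkℚ i d _) = ℚ.toℚᵘ-cancel-≤ (ℚᵘ.≤-respʳ-≃ (ℚᵘ.≃-sym (numeral ℤ.∣ i ∣))
    (ℚᵘ.*≤* (ℤ.≤-trans (ℤ.≤-reflexive (ℤ.*-identityʳ i)) (ℤ.≤-trans (i≤∣i∣ i) grow))))
    where
    grow : ℤ.+ ℤ.∣ i ∣ ℤ.≤ ℤ.+ ℤ.∣ i ∣ ℤ.* ℤ.+ suc d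
    grow = ≡.subst (ℤ.+ ℤ.∣ i ∣ ℤ.≤_) (ℤ.pos-* ℤ.∣ i ∣ (suc d)) (ℤ.+≤+ (ℕ.m≤m*n ℤ.∣ i ∣ (suc d)))

  ·-as-* : ∀ k y → k · y ≡ (k · 1ℚ) ℚ.* y
  ·-as-* zero    y = ≡.sym (ℚ.*-zeroˡ y)
  ·-as-* (suc k) y = ≡.trans (≡.cong₂ ℚ._+_ (≡.sym (ℚ.*-identityˡ y)) (·-as-* k y))
    (≡.sym (ℚ.*-distribʳ-+ y 1ℚ (k · 1ℚ)))

  archimedean : ∀ x {y} → 0ℚ ℚ.< y → ∃[ k ] ¬ (k · y ℚ.< x)
  archimedean x {y} 0<y = k , λ ky<x → ℚ.<-irrefl refl (ℚ.<-≤-trans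
    (ℚ.*-cancelʳ-<-nonNeg y {{ℚ.pos⇒nonNeg y {{ℚ.positive 0<y}}}}
      (≡.subst₂ ℚ._<_ (·-as-* k y) (≡.sym quotient*y) ky<x))
    (numerator-bound quotient))
    where
    instance
      y≢0 : ℚ.NonZero y
      y≢0 = ℚ.pos⇒nonZero y {{ℚ.positive 0<y}}
    quotient : ℚ
    quotient = x ℚ.* ℚ.1/ y
    k : ℕ
    k = ℤ.∣ ℚ.↥ quotient ∣
    quotient*y : quotient ℚ.* y ≡ x
    quotient*y = ≡.trans (ℚ.*-assoc x (ℚ.1/ y) y)
      (≡.trans (≡.cong (x ℚ.*_) (ℚ.*-inverseˡ y)) (ℚ.*-identityʳ x))

private
  module Q = OrderedFieldProperties ℚ-orderedField
open Q using (half)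
open Approximation ℚ-orderedField using
  (Close; close; close-refl; close-sym; close-trans; close-+; close-neg; close-<; close-mono;
   close-connex; half<;
   <-weaken; *-separation; reciprocal-close; ·-mono-≤)

-- The reals as an ordered field

Ultimately : (ℕ → Set) → Set
Ultimately P = ∃[ N ] ∀ n → N ℕ.≤ n → P n

ultimately-map₂ : ∀ {P Q R : ℕ → Set} → (∀ n → P n → Q n → R n) →
  Ultimately P → Ultimately Q → Ultimately R
ultimately-map₂ f (M , p) (N , q) = M ℕ.⊔ N , λ n n≥ →
  f n (p n (ℕ.m⊔n≤o⇒m≤o M N n≥)) (q n (ℕ.m⊔n≤o⇒n≤o M N n≥))

ultimately-map : ∀ {P Q : ℕ → Set} → (∀ n → P n → Q n) → Ultimately P → Ultimately Q
ultimately-map f (N , p) = N , λ n n≥ → f n (p n n≥)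

ultimately-const : ∀ {P : Set} → Ultimately (λ _ → P) → P
ultimately-const (N , p) = p N ℕ.≤-refl

p≤∣p∣ : ∀ p → p ℚ.≤ ∣ p ∣
p≤∣p∣ p with ℚ.≤-total 0ℚ p
... | inj₁ 0≤p = ℚ.≤-reflexive (≡.sym (ℚ.0≤p⇒∣p∣≡p 0≤p))
... | inj₂ p≤0 = ℚ.≤-trans p≤0 (ℚ.0≤∣p∣ p)

∣-∣⇒close : ∀ {ε} x y → ∣ x ℚ.- y ∣ ℚ.< ε → Close ε x y
∣-∣⇒close {ε} x y ∣x-y∣<ε = close
  (ℚ.≤-<-trans (p≤∣p∣ (x ℚ.- y)) ∣x-y∣<ε)
  (≡.subst (ℚ._< ε) (Q.solve 2 (λ x y → Q.:- (x Q.:- y) Q.:= y Q.:- x) refl x y)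
    (ℚ.≤-<-trans (p≤∣p∣ (ℚ.- (x ℚ.- y)))
      (≡.subst (ℚ._< ε) (≡.sym (ℚ.∣-p∣≡∣p∣ (x ℚ.- y))) ∣x-y∣<ε)))

close⇒∣-∣ : ∀ {ε} x y → Close ε x y → ∣ x ℚ.- y ∣ ℚ.< ε
close⇒∣-∣ {ε} x y (close l r) with ℚ.∣p∣≡p∨∣p∣≡-p (x ℚ.- y)
... | inj₁ ∣p∣≡p  = ≡.subst (ℚ._< ε) (≡.sym ∣p∣≡p) l
... | inj₂ ∣p∣≡-p = ≡.subst (ℚ._< ε) (≡.trans
  (Q.solve 2 (λ x y → y Q.:- x Q.:= Q.:- (x Q.:- y)) refl x y) (≡.sym ∣p∣≡-p)) r

≈⇒close : ∀ x y → x ≈ y → ∀ {ε} → 0ℚ ℚ.< ε → Ultimately (λ n → Close ε (seq x n) (seq y n))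
≈⇒close x y x≈y 0<ε = ultimately-map (λ n → ∣-∣⇒close (seq x n) (seq y n)) (x≈y _ 0<ε)

close⇒≈ : ∀ x y → (∀ {ε} → 0ℚ ℚ.< ε → Ultimately (λ n → Close ε (seq x n) (seq y n))) → x ≈ y
close⇒≈ x y h ε 0<ε = ultimately-map (λ n → close⇒∣-∣ (seq x n) (seq y n)) (h 0<ε)

≗⇒≈ : ∀ x y → (∀ n → seq x n ≡ seq y n) → x ≈ y
≗⇒≈ x y x≗y = close⇒≈ x y λ 0<ε → 0 , λ n _ →
  ≡.subst (Close _ (seq x n)) (x≗y n) (close-refl (seq x n) 0<ε)

≈-refl : ∀ {x} → x ≈ x
≈-refl {x} = ≗⇒≈ x x (λ _ → refl)

≈-sym : ∀ {x y} → x ≈ y → y ≈ x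
≈-sym {x} {y} x≈y = close⇒≈ y x λ 0<ε → ultimately-map (λ _ → close-sym) (≈⇒close x y x≈y 0<ε)

≈-trans : ∀ {x y z} → x ≈ y → y ≈ z → x ≈ z
≈-trans {x} {y} {z} x≈y y≈z = close⇒≈ x z λ 0<ε →
  let h , 0<h , h+h≡ε = half 0<ε
  in ultimately-map₂ (λ _ → close-trans h+h≡ε) (≈⇒close x y x≈y 0<h) (≈⇒close y z y≈z 0<h)

+-cong : ∀ {x y u v} → x ≈ y → u ≈ v → x + u ≈ y + v
+-cong {x} {y} {u} {v} x≈y u≈v = close⇒≈ (x + u) (y + v) λ 0<ε →
  let h , 0<h , h+h≡ε = half 0<ε
  in ultimately-map₂ (λ _ → close-+ h+h≡ε) (≈⇒close x y x≈y 0<h) (≈⇒close u v u≈v 0<h)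

neg-cong : ∀ {x y} → x ≈ y → - x ≈ - y
neg-cong {x} {y} x≈y = close⇒≈ (- x) (- y) λ 0<ε →
  ultimately-map (λ _ → close-neg) (≈⇒close x y x≈y 0<ε)

-- The estimate that makes products Cauchy also compares two products termwise, with δ = ε / (B +
-- C).
*-cong : ∀ {x y u v} → x ≈ y → u ≈ v → x * u ≈ y * v
*-cong {x} {y} {u} {v} x≈y u≈v ε 0<ε =
  let B , B>0 , x≤B = eventually-bounded (seq x) (cauchy x)
      C , C>0 , v≤C = eventually-bounded (seq v) (cauchy v)
      δ , 0<δ , [B+C]δ≡ε = shrink (B ℚ.+ C) ε {{ℚ.pos+pos⇒pos B {{B>0}} C {{C>0}}}} 0<ε
  in ultimately-map₂
       (λ n (x≤B , v≤C) (x~y , u~v) → ≡.subst (∣ seq x n ℚ.* seq u n ℚ.- seq y n ℚ.* seq v n ∣ ℚ.<_)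
         [B+C]δ≡ε (*-estimate B C δ {{B>0}} {{C>0}} (seq x n) (seq u n) (seq y n) (seq v n)
           x≤B v≤C x~y u~v))
       (ultimately-map₂ (λ _ → _,_) x≤B v≤C)
       (ultimately-map₂ (λ _ → _,_) (x≈y δ 0<δ) (u≈v δ 0<δ))

ℝ-commutativeRing : CommutativeRing 0ℓ 0ℓ
ℝ-commutativeRing = record
  { Carrier = ℝ ; _≈_ = _≈_ ; _+_ = _+_ ; _*_ = _*_ ; -_ = -_ ; 0# = 0ℝ ; 1# = 1ℝ
  ; isCommutativeRing = record
    { isRing = record
      { +-isAbelianGroup = record
        { isGroup = record
          { isMonoid = record
            { isSemigroup = record
              { isMagma = record
                { isEquivalence = record
                  { refl  = λ {x} → ≈-refl {x}
                  ; sym   = λ {x} {y} → ≈-sym {x} {y}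
                  ; trans = λ {x} {y} {z} → ≈-trans {x} {y} {z}
                  }
                ; ∙-cong = λ {x} {y} {u} {v} → +-cong {x} {y} {u} {v}
                }
              ; assoc = λ x y z → ≗⇒≈ (x + y + z) (x + (y + z))
                  (λ n → ℚ.+-assoc (seq x n) (seq y n) (seq z n))
              }
            ; identity = (λ x → ≗⇒≈ (0ℝ + x) x (λ n → ℚ.+-identityˡ (seq x n)))
                       , (λ x → ≗⇒≈ (x + 0ℝ) x (λ n → ℚ.+-identityʳ (seq x n)))
            }
          ; inverse = (λ x → ≗⇒≈ (- x + x) 0ℝ (λ n → ℚ.+-inverseˡ (seq x n)))
                    , (λ x → ≗⇒≈ (x + - x) 0ℝ (λ n → ℚ.+-inverseʳ (seq x n)))
          ; ⁻¹-cong = λ {x} {y} → neg-cong {x} {y}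
          }
        ; comm = λ x y → ≗⇒≈ (x + y) (y + x) (λ n → ℚ.+-comm (seq x n) (seq y n))
        }
      ; *-cong = λ {x} {y} {u} {v} → *-cong {x} {y} {u} {v}
      ; *-assoc = λ x y z → ≗⇒≈ (x * y * z) (x * (y * z))
          (λ n → ℚ.*-assoc (seq x n) (seq y n) (seq z n))
      ; *-identity = (λ x → ≗⇒≈ (1ℝ * x) x (λ n → ℚ.*-identityˡ (seq x n)))
                   , (λ x → ≗⇒≈ (x * 1ℝ) x (λ n → ℚ.*-identityʳ (seq x n)))
      ; distrib = (λ x y z → ≗⇒≈ (x * (y + z)) (x * y + x * z)
                    (λ n → ℚ.*-distribˡ-+ (seq x n) (seq y n) (seq z n)))
                , (λ x y z → ≗⇒≈ ((y + z) * x) (y * x + z * x)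
                    (λ n → ℚ.*-distribʳ-+ (seq x n) (seq y n) (seq z n)))
      }
    ; *-comm = λ x y → ≗⇒≈ (x * y) (y * x) (λ n → ℚ.*-comm (seq x n) (seq y n))
    }
  }

<-resp : ∀ {x y u v} → x ≈ u → y ≈ v → x < y → u < v
<-resp {x} {y} {u} {v} x≈u y≈v (ε , 0<ε , x+ε<y) =
  let h , 0<h , h+h≡ε = half 0<ε
      k , 0<k , k+k≡h = half 0<h
  in h , 0<h , ultimately-map₂ (λ _ x+ε<y (x~u , y~v) → close-< h+h≡ε k+k≡h x+ε<y x~u y~v) x+ε<y
       (ultimately-map₂ (λ _ → _,_) (≈⇒close x u x≈u 0<k) (≈⇒close y v y≈v 0<k))

<-irreflexive : ∀ {x} → ¬ (x < x)
<-irreflexive (ε , 0<ε , x+ε<x) = ultimately-const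
  (ultimately-map (λ n x+ε<x → ℚ.<-irrefl refl (<-weaken 0<ε x+ε<x)) x+ε<x)

<-transitive : ∀ {x y z} → x < y → y < z → x < z
<-transitive (ε , 0<ε , x+ε<y) (δ , 0<δ , y+δ<z) = ε , 0<ε ,
  ultimately-map₂ (λ _ x+ε<y y+δ<z → ℚ.<-trans x+ε<y (<-weaken 0<δ y+δ<z)) x+ε<y y+δ<z

+-monoˡ : ∀ z {x y} → x < y → x + z < y + z
+-monoˡ z {x} {y} (ε , 0<ε , x+ε<y) = ε , 0<ε , ultimately-map
  (λ n x+ε<y → ≡.subst (ℚ._< seq y n ℚ.+ seq z n)
    (Q.solve 3 (λ x ε z → x Q.:+ ε Q.:+ z Q.:= x Q.:+ z Q.:+ ε) refl (seq x n) ε (seq z n))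
    (ℚ.+-monoˡ-< (seq z n) x+ε<y)) x+ε<y

*-positive : ∀ {x y} → 0ℝ < x → 0ℝ < y → 0ℝ < x * y
*-positive (ε , 0<ε , ε<x) (δ , 0<δ , δ<y) =
  ε ℚ.* δ , OrderedField.*-pos ℚ-orderedField 0<ε 0<δ ,
  ultimately-map₂ (λ _ → *-separation 0<ε 0<δ) ε<x δ<y

-- Terms of x before ε < x takes hold may be 0; they get the junk reciprocal 1.
reciprocal : ∀ {x} → 0ℝ < x → ∃[ y ] x * y ≈ 1ℝ
reciprocal {x} (ε , 0<ε , N , ε<x) = x⁻¹ , ≈-inverse
  where
  reciprocal-above : ∀ q → ∃[ i ] 0ℚ ℚ.< i × (0ℚ ℚ.+ ε ℚ.< q → q ℚ.* i ≡ 1ℚ)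
  reciprocal-above q with (0ℚ ℚ.+ ε) ℚ.<? q
  ... | no  ε≮q = 1ℚ , ℚ.positive⁻¹ 1ℚ , λ ε<q → ⊥-elim (ε≮q ε<q)
  ... | yes ε<q =
    let i , 0<i , qi≡1 = Q.pos-reciprocal
          (ℚ.<-trans (≡.subst (0ℚ ℚ.<_) (≡.sym (ℚ.+-identityˡ ε)) 0<ε) ε<q)
    in i , 0<i , λ _ → qi≡1

  inverse-seq : ℕ → ℚ
  inverse-seq n = proj₁ (reciprocal-above (seq x n))

  inverse-pos : ∀ n → 0ℚ ℚ.< inverse-seq n
  inverse-pos n = proj₁ (proj₂ (reciprocal-above (seq x n)))

  is-inverse : ∀ n → N ℕ.≤ n → seq x n ℚ.* inverse-seq n ≡ 1ℚ
  is-inverse n N≤n = proj₂ (proj₂ (reciprocal-above (seq x n))) (ε<x n N≤n)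

  above-ε : ∀ n → N ℕ.≤ n → ε ℚ.< seq x n
  above-ε n N≤n = ≡.subst (ℚ._< seq x n) (ℚ.+-identityˡ ε) (ε<x n N≤n)

  inverse-cauchy : IsCauchy inverse-seq
  inverse-cauchy θ 0<θ =
    let j , 0<j , εj≡1 = Q.pos-reciprocal 0<ε
        0<j² = OrderedField.*-pos ℚ-orderedField 0<j 0<j
        δ , 0<δ , j²δ≡θ = shrink (j ℚ.* j) θ {{ℚ.positive 0<j²}} 0<θ
        M , x-cauchy = cauchy x δ 0<δ
    in M ℕ.⊔ N , λ m n m≥ n≥ →
       let N≤m = ℕ.m⊔n≤o⇒n≤o M N m≥
           N≤n = ℕ.m⊔n≤o⇒n≤o M N n≥
       in close⇒∣-∣ (inverse-seq m) (inverse-seq n)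
            (≡.subst (λ θ → Close θ (inverse-seq m) (inverse-seq n)) j²δ≡θ
              (reciprocal-close 0<δ εj≡1 0<ε 0<j (above-ε m N≤m) (above-ε n N≤n)
                (inverse-pos m) (inverse-pos n) (is-inverse m N≤m) (is-inverse n N≤n)
                (∣-∣⇒close (seq x m) (seq x n)
                  (x-cauchy m n (ℕ.m⊔n≤o⇒m≤o M N m≥) (ℕ.m⊔n≤o⇒m≤o M N n≥)))))

  x⁻¹ : ℝ
  x⁻¹ = mkℝ inverse-seq inverse-cauchy

  ≈-inverse : x * x⁻¹ ≈ 1ℝ
  ≈-inverse = close⇒≈ (x * x⁻¹) 1ℝ λ {δ} 0<δ → N , λ n N≤n →
    ≡.subst (λ q → Close δ q 1ℚ) (≡.sym (is-inverse n N≤n)) (close-refl 1ℚ 0<δ)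

open RawMonoid (CommutativeRing.+-rawMonoid ℝ-commutativeRing) using () renaming (_×_ to _·_)
open RawMonoid ℚ.+-0-rawMonoid using () renaming (_×_ to _·ℚ_)

seq-· : ∀ k x n → seq (k · x) n ≡ k ·ℚ seq x n
seq-· zero    x n = refl
seq-· (suc k) x n = ≡.cong (seq x n ℚ.+_) (seq-· k x n)

-- Ultimately x is at most a rational B and y exceeds a rational ε > 0, so the multiple that works
-- for B and ε over ℚ works here.
archimedean-ℝ : ∀ x {y} → 0ℝ < y → ∃[ k ] ¬ (k · y < x)
archimedean-ℝ x {y} (ε , 0<ε , ε<y) =
  let B , _ , x≤B = eventually-bounded (seq x) (cauchy x)
      k , kε≮B = OrderedField.archimedean ℚ-orderedField B 0<ε
  in k , λ (δ , 0<δ , ky+δ<x) → ultimately-const (ultimately-map₂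
       (λ n (∣x∣≤B , ε<y) ky+δ<x →
         ·-mono-≤ k (≡.subst (ℚ._< seq y n) (ℚ.+-identityˡ ε) ε<y)
           (ℚ.<-≤-trans (≡.subst (ℚ._< seq x n) (seq-· k y n) (<-weaken 0<δ ky+δ<x))
             (ℚ.≤-trans (p≤∣p∣ (seq x n)) (ℚ.≤-trans ∣x∣≤B (ℚ.≮⇒≥ kε≮B)))))
       (ultimately-map₂ (λ _ → _,_) x≤B ε<y) ky+δ<x)

-- The only field axiom that calls on excluded middle. Beyond an index L both sequences stay near
-- their terms at L. If those terms differed by more than l = ε/8, one sequence would remain
-- strictly above the other, which is excluded; so the terms at L, and then all later ones, are
-- close.
connex : ExcludedMiddle 0ℓ → ∀ x y → x < y ⊎ x ≈ y ⊎ y < x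
connex em x y with em {x < y} | em {y < x}
... | yes x<y | _       = inj₁ x<y
... | no _    | yes y<x = inj₂ (inj₂ y<x)
... | no x≮y  | no y≮x  = inj₂ (inj₁ (close⇒≈ x y λ {ε} 0<ε →
  let h , 0<h , h+h≡ε = half 0<ε
      k , 0<k , k+k≡h = half 0<h
      l , 0<l , l+l≡k = half 0<k
      m , 0<m , m+m≡l = half 0<l
      p , 0<p , p+p≡m = half 0<m
      p<k = ℚ.<-trans (half< 0<p p+p≡m) (ℚ.<-trans (half< 0<m m+m≡l) (half< 0<l l+l≡k))
      M , x-cauchy = cauchy x p 0<p
      N , y-cauchy = cauchy y p 0<p
      L = M ℕ.⊔ N
      x~ = λ n (n≥ : L ℕ.≤ n) → ∣-∣⇒close (seq x L) (seq x n)
             (x-cauchy L n (ℕ.m≤m⊔n M N) (ℕ.m⊔n≤o⇒m≤o M N n≥))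
      y~ = λ n (n≥ : L ℕ.≤ n) → ∣-∣⇒close (seq y L) (seq y n)
             (y-cauchy L n (ℕ.m≤n⊔m M N) (ℕ.m⊔n≤o⇒n≤o M N n≥))
      -- Moving from L to n costs at most p = ε/32 on each side, so a gap l at L leaves the gap m =
      -- l/2 at every later n.
      x≮ = λ x+l<y → x≮y (m , 0<m , L , λ n n≥ → close-< m+m≡l p+p≡m x+l<y (x~ n n≥) (y~ n n≥))
      y≮ = λ y+l<x → y≮x (m , 0<m , L , λ n n≥ → close-< m+m≡l p+p≡m y+l<x (y~ n n≥) (x~ n n≥))
      xL~yL = close-connex (half< 0<l l+l≡k) y≮ x≮
  in L , λ n n≥ → close-trans h+h≡ε
       (close-trans k+k≡h (close-mono p<k (close-sym (x~ n n≥))) xL~yL)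
       (close-mono (ℚ.<-trans p<k (half< 0<k k+k≡h)) (y~ n n≥))))

ℝ-orderedField : ExcludedMiddle 0ℓ → OrderedField
ℝ-orderedField em = record
  { commutativeRing = ℝ-commutativeRing
  ; _<_             = _<_
  ; <-resp-≈        = λ {x} {y} {u} {v} → <-resp {x} {y} {u} {v}
  ; <-irrefl        = λ {x} → <-irreflexive {x}
  ; <-trans         = λ {x} {y} {z} → <-transitive {x} {y} {z}
  ; <-connex        = connex em
  ; +-monoˡ-<       = λ z {x} {y} → +-monoˡ z {x} {y}
  ; *-pos           = λ {x} {y} → *-positive {x} {y}
  ; pos-inverse     = λ {x} → reciprocal {x}
  ; 0<1             = ½ , ℚ.positive⁻¹ ½ , 0 , λ _ _ → ℚ.*<* (ℤ.+<+ (ℕ.s≤s (ℕ.s≤s ℕ.z≤n)))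
  ; archimedean     = λ x {y} → archimedean-ℝ x {y}
  }

-- From pairwise adjacent vertices to the copy of K₄

clique⇒subgraph : ∀ {m n} (G : Graph n) (f : Fin m → Fin n) →
  (∀ {k l} → k ≢ l → Adjacent G (f k) (f l)) →
  ∃[ S ] (∀ k → f k ∈ vertices {G = G} S) × S ≅ K m
clique⇒subgraph G f adjacent = record
  { vertices       = λ i → ∃[ k ] f k ≡ i
  ; edges          = λ i j → Adjacent G i j × (∃[ k ] f k ≡ i) × (∃[ l ] f l ≡ j)
  ; edges-sym      = λ (i~j , i∈ , j∈) → symmetric G i~j , j∈ , i∈
  ; edges⇒adjacent = proj₁
  ; edges⇒vertices = proj₂
  } , (λ k → k , refl) , record
  { to        = f
  -- Distinct indices have adjacent images, and no vertex is adjacent to itself.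
  ; injective = λ {k} {l} fk≡fl → decidable-stable (k Fin.≟ l) λ k≢l →
      loopless G fk≡fl (adjacent k≢l)
  ; image     = λ _ → mk⇔ id id
  ; edges⇔    = λ k l → mk⇔
      (λ (fk~fl , _) k≡l → loopless G (≡.cong f k≡l) fk~fl)
      (λ k≢l → adjacent k≢l , (k , refl) , (l , refl))
  }

lookup-pairs : ∀ {A : Set} (R : Rel A 0ℓ) → Symmetric R → ∀ {xs} → AllPairs R xs →
  ∀ {k l} → k ≢ l → R (lookup xs k) (lookup xs l)
lookup-pairs R sym (_ ∷ _)      {zero}  {zero}  k≢l = ⊥-elim (k≢l refl)
lookup-pairs R sym (x~xs ∷ _)   {zero}  {suc l} _   = All.lookup x~xs (∈-lookup l)
lookup-pairs R sym (x~xs ∷ _)   {suc k} {zero}  _   = sym (All.lookup x~xs (∈-lookup k))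
lookup-pairs R sym (_ ∷ xs~xs)  {suc k} {suc l} k≢l = lookup-pairs R sym xs~xs 
  (λ k≡l → k≢l (≡.cong suc k≡l))

theorem3 : ExcludedMiddle 0ℓ →
    ∀ {n} (G : Graph n) (R : VisibilityRepresentation G) → ConvexCompact R →
    ∀ (A B V W : Fin n) (a b v w : Point) →
    Unique (A ∷ B ∷ V ∷ W ∷ []) →
    IsSightline (region R) A B a b →
    IsSightline (region R) V W v w →
    Satisfiable (segment a b ∩ segment v w) →
    ∃[ S ] A ∈ vertices {G = G} S × B ∈ vertices S × S ≅ K 4
theorem3 em {n} G R convexCompact A B V W a b v w
  ((A≢B ∷ A≢V ∷ A≢W ∷ []) ∷ (B≢V ∷ B≢W ∷ []) ∷ _) ab vw (x , x∈ab , x∈vw) =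
  let S , f∈S , S≅K₄ = clique⇒subgraph G (lookup corners) λ {k} {l} →
        lookup-pairs (Adjacent G) (symmetric G) adjacent-corners {k} {l}
  in S , f∈S zero , f∈S (suc zero) , S≅K₄
  where
  𝔽 = ℝ-orderedField em
  module Geometry = PlaneGeometry 𝔽
  open PlaneCompactness 𝔽 em using (compact⇒subcovers)
  open PlaneVisibility 𝔽 em

  arrangement : Arrangement n
  arrangement = record
    { region      = region R
    ; extensional = λ C → extensional R C
    ; convex      = λ C p∈C q∈C r∈ → proj₁ (convexCompact C) p∈C q∈C (Geometry.segment⇒mix r∈)
    ; subcovers   = λ C → compact⇒subcovers (proj₂ (convexCompact C))
    ; disjoint    = λ C≢D {p} p∈C p∈D → disjoint R C≢D p (p∈C , p∈D)
    }

  open Sightlines arrangement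

  avoids : ∀ {C D p q} → IsSightline (region R) C D p q →
    ∀ E → E ≢ C → E ≢ D → ∀ {r} → Geometry.segment p q r → ¬ region R E r
  avoids sightline E E≢C E≢D {r} r∈pq r∈E =
    IsSightline.clear sightline E E≢C E≢D r (Geometry.segment⇒mix r∈pq , r∈E)

  adjacent : ∀ {C D} → C ≢ D → Sees C D → Adjacent G C D
  adjacent C≢D (p , q , p∈C , q∈D , clear) = Equivalence.from (visibility R C≢D)
    (p , q , record
      { distinct = C≢D ; start = p∈C ; end = q∈D
      ; clear = λ E E≢C E≢D r (r∈pq , r∈E) → clear E E≢C E≢D (Geometry.mix⇒segment p q r r∈pq) r∈E })

  adjacent-AB : Adjacent G A B
  adjacent-AB = Equivalence.from (visibility R A≢B) (a , b , ab)

  neighbours : AdjacentCommonNeighbours A B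
  neighbours = crossing⇒neighbours A≢B (≢-sym A≢V) (≢-sym B≢V) (≢-sym A≢W) (≢-sym B≢W)
    (IsSightline.start ab) (IsSightline.end ab) (IsSightline.start vw) (IsSightline.end vw)
    (avoids ab) (avoids vw A A≢V A≢W) (avoids vw B B≢V B≢W)
    (Geometry.mix⇒segment a b x x∈ab) (Geometry.mix⇒segment v w x x∈vw)

  open AdjacentCommonNeighbours neighbours

  corners : List (Fin n)
  corners = A ∷ B ∷ E ∷ F ∷ []

  adjacent-corners : AllPairs (Adjacent G) corners
  adjacent-corners =
    (adjacent-AB ∷ symmetric G (adjacent E≢A E-sees-A) ∷ symmetric G (adjacent F≢A F-sees-A) ∷ []) ∷
    (symmetric G (adjacent E≢B E-sees-B) ∷ symmetric G (adjacent F≢B F-sees-B) ∷ []) ∷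
    (adjacent E≢F E-sees-F ∷ []) ∷ [] ∷ []
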